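{- The encodings $\mathcal{T}_{\rm B}$ (Boudol) and $\mathcal{T}_{\rm HT}$ (Honda \& Tokoro) of the synchronous $\pi$-calculus into the asynchronous $\pi$-calculus are valid up to success respecting weak reduction bisimilarity; that is, extending each encoding by mapping the success constant √ to √, every process $P$ of the synchronous $\pi$-calculus extended with √ is related to its translation by success respecting weak reduction bisimilarity.
   Context: The source language $\pi$ is the $\pi$-calculus without matching, $\tau$-prefixing and choice: $P ::= \mathbf{0} \mid \bar xz.P \mid x(y).P \mid P|Q \mid (\nu y)P \mid\ !P$, with the usual structural congruence and reduction relation $\longmapsto$ (generated by $\bar xz.P \mid x(y).Q \longmapsto P \mid Q\{z/y\}$, closed under parallel composition, restriction and structural congruence). The target language $\mathrm{a}\pi$ (asynchronous $\pi$-calculus) is the sublanguage where every output has the form $\bar xz.\mathbf{0}$, written $\bar xz$. Boudol's encoding $\mathcal{T}_{\rm B}$ is homomorphic on $\mathbf{0}$, $|$, $!$ and restriction, and sets $\mathcal{T}_{\rm B}(\bar xz.P) = (\nu u)(\bar xu \mid u(v).(\bar vz \mid \mathcal{T}_{\rm B}(P)))$ and $\mathcal{T}_{\rm B}(x(y).P) = x(u).(\nu v)(\bar uv \mid v(y).\mathcal{T}_{\rm B}(P))$, with $u\neq v$ fresh. The Honda–Tokoro encoding $\mathcal{T}_{\rm HT}$ is homomorphic on the same operators and sets $\mathcal{T}_{\rm HT}(\bar xz.P) = x(u).(\bar uz \mid \mathcal{T}_{\rm HT}(P))$ and $\mathcal{T}_{\rm HT}(x(y).P) = (\nu u)(\bar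 xu \mid u(y).\mathcal{T}_{\rm HT}(P))$, with $u$ fresh. Both languages are extended with a success constant √; a process has the success barb if it has a top-level unguarded occurrence of √, and weakly has it if it reduces in zero or more steps to such a process. A symmetric relation $S$ on the union of the extended source and target processes is a success respecting weak reduction bisimulation if $P\,S\,Q$ implies (1) if $P$ has the success barb then $Q$ weakly has it, and (2) if $P\longmapsto P'$ then there is $Q'$ with $Q\longmapsto^* Q'$ and $P'\,S\,Q'$. Success respecting weak reduction bisimilarity is the largest such relation. A compositional encoding $\mathcal{T}$ is valid up to this equivalence if its extension with $\mathcal{T}(√)=√$ relates $\mathcal{T}(P)$ and $P$ for every extended source process $P$. -}

module Defs where

open import Level using (0ℓ)
open import Data.Nat using (ℕ; zero; suc)
open import Data.Fin using (Fin; zero; suc)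
open import Data.Product using (Σ; ∃; _×_; _,_)
open import Relation.Binary using (Rel; Symmetric)
open import Relation.Binary.Construct.Closure.ReflexiveTransitive using (Star)

-- Names are scoped de Bruijn indices:
-- a process in Proc n has its free names among Fin n.  The binders are
-- input  x(y).P  (binds index 0 of P) and restriction (ν y)P.
-- The asynchronous π-calculus aπ is the sublanguage in which every output
-- has continuation 𝟘; it is a subset of Proc, so the union of source and
-- target processes is Proc itself.

data Proc (n : ℕ) : Set where
  𝟘    : Proc n
  out  : Fin n → Fin n → Proc n → Proc n          -- x̄z.P
  inp  : Fin n → Proc (suc n) → Proc n            -- x(y).P
  _∣_  : Proc n → Proc n → Proc n
  ν    : Proc (suc n) → Proc n
  !_   : Proc n → Proc n
  √    : Proc n

infixr 5 _∣_

aout : ∀ {n} → Fin n → Fin n → Proc n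
aout x z = out x z 𝟘

lift : ∀ {n m} → (Fin n → Fin m) → Fin (suc n) → Fin (suc m)
lift ρ zero    = zero
lift ρ (suc i) = suc (ρ i)

rename : ∀ {n m} → (Fin n → Fin m) → Proc n → Proc m
rename ρ 𝟘           = 𝟘
rename ρ (out x z P) = out (ρ x) (ρ z) (rename ρ P)
rename ρ (inp x P)   = inp (ρ x) (rename (lift ρ) P)
rename ρ (P ∣ Q)     = rename ρ P ∣ rename ρ Q
rename ρ (ν P)       = ν (rename (lift ρ) P)
rename ρ (! P)       = ! rename ρ P
rename ρ √           = √

wk : ∀ {n} → Proc n → Proc (suc n)
wk = rename suc

swapρ : ∀ {n} → Fin (suc (suc n)) → Fin (suc (suc n))
swapρ zero          = suc zero
swapρ (suc zero)    = zero
swapρ (suc (suc i)) = suc (suc i)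

-- Q{z/y} where y is the bound name (index 0) of Q
substρ : ∀ {n} → Fin n → Fin (suc n) → Fin n
substρ z zero    = z
substρ z (suc i) = i

_[_] : ∀ {n} → Proc (suc n) → Fin n → Proc n
Q [ z ] = rename (substρ z) Q

-- Structural congruence (α-conversion is built into de Bruijn syntax)

infix 4 _≡ₛ_
data _≡ₛ_ {n : ℕ} : Proc n → Proc n → Set where
  s-refl  : ∀ {P} → P ≡ₛ P
  s-sym   : ∀ {P Q} → P ≡ₛ Q → Q ≡ₛ P
  s-trans : ∀ {P Q R} → P ≡ₛ Q → Q ≡ₛ R → P ≡ₛ R
  s-out   : ∀ {x z P Q} → P ≡ₛ Q → out x z P ≡ₛ out x z Q
  s-inp   : ∀ {x P Q} → _≡ₛ_ {suc n} P Q → inp x P ≡ₛ inp x Q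
  s-par   : ∀ {P P' Q Q'} → P ≡ₛ P' → Q ≡ₛ Q' → (P ∣ Q) ≡ₛ (P' ∣ Q')
  s-res   : ∀ {P Q} → _≡ₛ_ {suc n} P Q → ν P ≡ₛ ν Q
  s-rep   : ∀ {P Q} → P ≡ₛ Q → ! P ≡ₛ ! Q
  par-unit  : ∀ {P} → (P ∣ 𝟘) ≡ₛ P
  par-comm  : ∀ {P Q} → (P ∣ Q) ≡ₛ (Q ∣ P)
  par-assoc : ∀ {P Q R} → ((P ∣ Q) ∣ R) ≡ₛ (P ∣ (Q ∣ R))
  rep-unf   : ∀ {P} → ! P ≡ₛ (P ∣ ! P)
  res-nil   : ν 𝟘 ≡ₛ 𝟘
  res-swap  : ∀ {P : Proc (suc (suc n))} → ν (ν P) ≡ₛ ν (ν (rename swapρ P))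
  -- scope extrusion: (ν y)(P | Q) ≡ P | (ν y)Q  when y ∉ fn(P)
  res-extr  : ∀ {P Q} → ν (wk P ∣ Q) ≡ₛ (P ∣ ν Q)

infix 4 _⟶_
data _⟶_ {n : ℕ} : Proc n → Proc n → Set where
  r-comm   : ∀ {x z P Q} → (out x z P ∣ inp x Q) ⟶ (P ∣ Q [ z ])
  r-par    : ∀ {P P' Q} → P ⟶ P' → (P ∣ Q) ⟶ (P' ∣ Q)
  r-res    : ∀ {P P'} → _⟶_ {suc n} P P' → ν P ⟶ ν P'
  r-struct : ∀ {P P' Q Q'} → P ≡ₛ P' → P' ⟶ Q' → Q' ≡ₛ Q → P ⟶ Q

infix 4 _⟶*_
_⟶*_ : ∀ {n} → Proc n → Proc n → Set
_⟶*_ = Star _⟶_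

data HasSuccess {n : ℕ} : Proc n → Set where
  succ-√   : HasSuccess √
  succ-parˡ : ∀ {P Q} → HasSuccess P → HasSuccess (P ∣ Q)
  succ-parʳ : ∀ {P Q} → HasSuccess Q → HasSuccess (P ∣ Q)
  succ-res : ∀ {P} → HasSuccess {suc n} P → HasSuccess (ν P)
  succ-rep : ∀ {P} → HasSuccess P → HasSuccess (! P)

WeaklyHasSuccess : ∀ {n} → Proc n → Set
WeaklyHasSuccess P = ∃ λ P' → P ⟶* P' × HasSuccess P'

record IsSRWRBisim {n : ℕ} (S : Rel (Proc n) 0ℓ) : Set where
  field
    symm    : Symmetric S
    success : ∀ {P Q} → S P Q → HasSuccess P → WeaklyHasSuccess Q
    step    : ∀ {P Q P'} → S P Q → P ⟶ P' → ∃ λ Q' → Q ⟶* Q' × S P' Q'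

-- bisimilarity: the largest such relation, i.e. the union of all of them
infix 4 _≈_
_≈_ : ∀ {n} → Proc n → Proc n → Set₁
P ≈ Q = Σ (Rel (Proc _) 0ℓ) λ S → IsSRWRBisim S × S P Q

wk2lift : ∀ {n} → Fin (suc n) → Fin (suc (suc (suc n)))
wk2lift = lift (λ i → suc (suc i))

T-B : ∀ {n} → Proc n → Proc n
T-B 𝟘           = 𝟘
-- (ν u)(x̄u | u(v).(v̄z | T P))
T-B (out x z P) = ν (aout (suc x) zero
                     ∣ inp zero (aout zero (suc (suc z))
                                 ∣ rename (λ i → suc (suc i)) (T-B P)))
-- x(u).(ν v)(ūv | v(y).T P)
T-B (inp x P)   = inp x (ν (aout (suc zero) zero
                            ∣ inp zero (rename wk2lift (T-B P))))
T-B (P ∣ Q)     = T-B P ∣ T-B Q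
T-B (ν P)       = ν (T-B P)
T-B (! P)       = ! T-B P
T-B √           = √

T-HT : ∀ {n} → Proc n → Proc n
T-HT 𝟘           = 𝟘
-- x(u).(ūz | T P)
T-HT (out x z P) = inp x (aout zero (suc z) ∣ wk (T-HT P))
-- (ν u)(x̄u | u(y).T P)
T-HT (inp x P)   = ν (aout (suc x) zero ∣ inp zero (rename (lift suc) (T-HT P)))
T-HT (P ∣ Q)     = T-HT P ∣ T-HT Q
T-HT (ν P)       = ν (T-HT P)
T-HT (! P)       = ! T-HT P
T-HT √           = √

-- Both encodings mimic a source communication x̄z.P ∣ x(y).Q by one reduction on x
-- followed by administrative reductions on private names, ending in ⟦P⟧ ∣ ⟦Q{z/y}⟧.
-- The bisimulation relates each partially executed translation, up to structural
-- congruence, to the source process it stands for, in both directions. A target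
-- reduction is analysed as a τ-transition of a labelled transition system in harmony
-- with reduction: since the first action of a translated prefix always binds a name,
-- it is either administrative, leaving the source unchanged, or the close of a bound
-- output with an input, which matches a source communication. In the other direction
-- a partially executed translation completes its administrative steps and then
-- simulates every source reduction. Success barbs are preserved and reflected because
-- translated prefixes, like source prefixes, guard their continuations.

module Submission where

open import Data.Bool using (Bool; true; false)
open import Data.Empty using (⊥; ⊥-elim)
open import Data.Fin using (Fin; zero; suc)
open import Data.Fin.Properties using (suc-injective)
open import Data.Nat using (ℕ; zero; suc)
open import Data.Product using (∃; _×_; _,_; proj₂)
open import Data.Sum using (_⊎_; inj₁; inj₂)
open import Function using (id)
open import Function.Bundles using (_⇔_; mk⇔; Equivalence)
open import Function.Definitions using (Injective)
import Function.Properties.Equivalence as ⇔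
open import Level using (0ℓ)
open import Relation.Binary using (Rel)
open import Relation.Binary.Bundles using (Setoid)
open import Relation.Binary.Construct.Closure.ReflexiveTransitive using (ε; _◅_; _◅◅_; gmap)
open import Relation.Binary.PropositionalEquality using (_≡_; refl; sym; trans; cong; cong₂; subst)
import Relation.Binary.Reasoning.Setoid as SetoidReasoning
open import Relation.Nullary using (¬_)

open import Defs

private
  variable
    n m : ℕ
    b : Bool
    x y z : Fin n
    P P′ Q Q′ R R′ S S′ X Y : Proc n
    ρ σ ρ′ σ′ θ : Fin n → Fin m

cong₃ : ∀ {A B C D : Set} (f : A → B → C → D) {a a′ b b′ c c′} →
        a ≡ a′ → b ≡ b′ → c ≡ c′ → f a b c ≡ f a′ b′ c′
cong₃ f refl refl refl = refl

lift-square : (∀ i → ρ (σ i) ≡ ρ′ (σ′ i)) → ∀ i → lift ρ (lift σ i) ≡ lift ρ′ (lift σ′ i)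
lift-square h zero    = refl
lift-square h (suc i) = cong suc (h i)

rename-square : (∀ i → ρ (σ i) ≡ ρ′ (σ′ i)) →
                ∀ P → rename ρ (rename σ P) ≡ rename ρ′ (rename σ′ P)
rename-square h 𝟘           = refl
rename-square h (out x z P) = cong₃ out (h x) (h z) (rename-square h P)
rename-square h (inp x P)   = cong₂ inp (h x) (rename-square (lift-square h) P)
rename-square h (P ∣ Q)     = cong₂ _∣_ (rename-square h P) (rename-square h Q)
rename-square h (ν P)       = cong ν (rename-square (lift-square h) P)
rename-square h (! P)       = cong !_ (rename-square h P)
rename-square h √           = refl

lift-id : {ρ : Fin n → Fin n} → (∀ i → ρ i ≡ i) → ∀ i → lift ρ i ≡ i
lift-id h zero    = refl
lift-id h (suc i) = cong suc (h i)

rename-id : {ρ : Fin n → Fin n} → (∀ i → ρ i ≡ i) → ∀ P → rename ρ P ≡ P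
rename-id h 𝟘           = refl
rename-id h (out x z P) = cong₃ out (h x) (h z) (rename-id h P)
rename-id h (inp x P)   = cong₂ inp (h x) (rename-id (lift-id h) P)
rename-id h (P ∣ Q)     = cong₂ _∣_ (rename-id h P) (rename-id h Q)
rename-id h (ν P)       = cong ν (rename-id (lift-id h) P)
rename-id h (! P)       = cong !_ (rename-id h P)
rename-id h √           = refl

rename-fuse : (∀ i → ρ (σ i) ≡ θ i) → ∀ P → rename ρ (rename σ P) ≡ rename θ P
rename-fuse {θ = θ} h P =
  trans (rename-square {σ′ = id} h P) (cong (rename θ) (rename-id (λ _ → refl) P))

rename-lift-wk : ∀ (ρ : Fin n → Fin m) P → rename (lift ρ) (wk P) ≡ wk (rename ρ P)
rename-lift-wk ρ = rename-square λ _ → refl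

rename-lift-lift-suc : ∀ (ρ : Fin n → Fin m) (S : Proc (suc n)) →
  rename (lift (lift ρ)) (rename (lift suc) S) ≡ rename (lift suc) (rename (lift ρ) S)
rename-lift-lift-suc ρ = rename-square λ { zero → refl ; (suc _) → refl }

wk-[] : ∀ (z : Fin n) P → wk P [ z ] ≡ P
wk-[] z P = trans (rename-fuse {θ = id} (λ _ → refl) P) (rename-id (λ _ → refl) P)

rename-[] : ∀ (ρ : Fin n → Fin m) z (Q : Proc (suc n)) →
            rename ρ (Q [ z ]) ≡ rename (lift ρ) Q [ ρ z ]
rename-[] ρ z = rename-square λ { zero → refl ; (suc _) → refl }

private
  substρ-suc-swapρ : ∀ (z : Fin n) i → lift (substρ z) (swapρ i) ≡ substρ (suc z) i
  substρ-suc-swapρ z zero          = refl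
  substρ-suc-swapρ z (suc zero)    = refl
  substρ-suc-swapρ z (suc (suc i)) = refl

  substρ-lift-suc : ∀ (z : Fin n) i → substρ (suc z) (lift suc i) ≡ suc (substρ z i)
  substρ-lift-suc z zero    = refl
  substρ-lift-suc z (suc i) = refl

res-[] : ∀ (z : Fin n) (Q : Proc (suc (suc n))) → ν (Q [ suc z ]) ≡ ν (rename swapρ Q) [ z ]
res-[] z Q = cong ν (sym (rename-fuse (substρ-suc-swapρ z) Q))

lift-suc-[zero] : ∀ (P : Proc (suc n)) → rename (lift suc) P [ zero ] ≡ P
lift-suc-[zero] P = trans (rename-fuse {θ = id} (λ { zero → refl ; (suc _) → refl }) P)
                          (rename-id (λ _ → refl) P)

lift-suc-[suc] : ∀ (z : Fin n) P → rename (lift suc) P [ suc z ] ≡ wk (P [ z ])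
lift-suc-[suc] z = rename-square (substρ-lift-suc z)

swapρ-involutive : ∀ (i : Fin (suc (suc n))) → swapρ (swapρ i) ≡ i
swapρ-involutive zero          = refl
swapρ-involutive (suc zero)    = refl
swapρ-involutive (suc (suc i)) = refl

rename-swapρ-involutive : ∀ (P : Proc (suc (suc n))) → rename swapρ (rename swapρ P) ≡ P
rename-swapρ-involutive P = trans (rename-fuse (λ _ → refl) P) (rename-id swapρ-involutive P)

swapρ-lift-lift : ∀ (ρ : Fin n → Fin m) i → swapρ (lift (lift ρ) i) ≡ lift (lift ρ) (swapρ i)
swapρ-lift-lift ρ zero          = refl
swapρ-lift-lift ρ (suc zero)    = refl
swapρ-lift-lift ρ (suc (suc i)) = refl

rename-swapρ-lift-lift : ∀ (ρ : Fin n → Fin m) P →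
  rename (lift (lift ρ)) (rename swapρ P) ≡ rename swapρ (rename (lift (lift ρ)) P)
rename-swapρ-lift-lift ρ = rename-square λ i → sym (swapρ-lift-lift ρ i)

swapρ-suc : ∀ (i : Fin (suc n)) → swapρ (suc i) ≡ lift suc i
swapρ-suc zero    = refl
swapρ-suc (suc i) = refl

swapρ-lift-suc : ∀ (i : Fin (suc n)) → swapρ (lift suc i) ≡ suc i
swapρ-lift-suc zero    = refl
swapρ-lift-suc (suc i) = refl

≡⇒≡ₛ : P ≡ Q → P ≡ₛ Q
≡⇒≡ₛ refl = s-refl

≡ₛ-setoid : ℕ → Setoid 0ℓ 0ℓ
≡ₛ-setoid n = record
  { Carrier       = Proc n
  ; _≈_           = _≡ₛ_
  ; isEquivalence = record { refl = s-refl ; sym = s-sym ; trans = s-trans }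
  }

module ≡ₛ-Reasoning {n} = SetoidReasoning (≡ₛ-setoid n)

rename-≡ₛ : ∀ (ρ : Fin n → Fin m) → P ≡ₛ Q → rename ρ P ≡ₛ rename ρ Q
rename-≡ₛ ρ s-refl        = s-refl
rename-≡ₛ ρ (s-sym e)     = s-sym (rename-≡ₛ ρ e)
rename-≡ₛ ρ (s-trans e f) = s-trans (rename-≡ₛ ρ e) (rename-≡ₛ ρ f)
rename-≡ₛ ρ (s-out e)     = s-out (rename-≡ₛ ρ e)
rename-≡ₛ ρ (s-inp e)     = s-inp (rename-≡ₛ (lift ρ) e)
rename-≡ₛ ρ (s-par e f)   = s-par (rename-≡ₛ ρ e) (rename-≡ₛ ρ f)
rename-≡ₛ ρ (s-res e)     = s-res (rename-≡ₛ (lift ρ) e)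
rename-≡ₛ ρ (s-rep e)     = s-rep (rename-≡ₛ ρ e)
rename-≡ₛ ρ par-unit      = par-unit
rename-≡ₛ ρ par-comm      = par-comm
rename-≡ₛ ρ par-assoc     = par-assoc
rename-≡ₛ ρ rep-unf       = rep-unf
rename-≡ₛ ρ res-nil       = res-nil
rename-≡ₛ ρ (res-swap {P = P}) =
  s-trans res-swap (s-res (s-res (≡⇒≡ₛ (sym (rename-swapρ-lift-lift ρ P)))))
rename-≡ₛ ρ (res-extr {P = P} {Q = Q}) =
  s-trans (≡⇒≡ₛ (cong (λ W → ν (W ∣ rename (lift ρ) Q)) (rename-lift-wk ρ P))) res-extr

parˡ-≡ₛ : P ≡ₛ P′ → (P ∣ Q) ≡ₛ (P′ ∣ Q)
parˡ-≡ₛ e = s-par e s-refl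

parʳ-≡ₛ : Q ≡ₛ Q′ → (P ∣ Q) ≡ₛ (P ∣ Q′)
parʳ-≡ₛ e = s-par s-refl e

par-unitˡ : (𝟘 ∣ P) ≡ₛ P
par-unitˡ = s-trans par-comm par-unit

par-leftComm : (P ∣ (Q ∣ R)) ≡ₛ (Q ∣ (P ∣ R))
par-leftComm = s-trans (s-sym par-assoc) (s-trans (parˡ-≡ₛ par-comm) par-assoc)

par-rightComm : ((P ∣ Q) ∣ R) ≡ₛ ((P ∣ R) ∣ Q)
par-rightComm = s-trans par-assoc (s-trans (parʳ-≡ₛ par-comm) (s-sym par-assoc))

res-extrʳ : ν (Q ∣ wk P) ≡ₛ (ν Q ∣ P)
res-extrʳ = s-trans (s-res par-comm) (s-trans res-extr par-comm)

res-wk : ν (wk P) ≡ₛ P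
res-wk = s-trans (s-res (s-sym par-unit)) (s-trans res-extr (s-trans (parʳ-≡ₛ res-nil) par-unit))

res-res-lift-suc : {P : Proc (suc n)} → ν (ν (rename (lift suc) P)) ≡ₛ ν P
res-res-lift-suc {P = P} =
  s-trans res-swap (s-trans (s-res (s-res (≡⇒≡ₛ (rename-fuse swapρ-lift-suc P)))) (s-res res-wk))

-- Labelled transitions

-- An action with b = true binds a name: the received or extruded name is index 0
-- of the target.
_⊕_ : ℕ → Bool → ℕ
n ⊕ false = n
n ⊕ true  = suc n

data Action (n : ℕ) : Bool → Set where
  τ     : Action n false
  fout  : Fin n → Fin n → Action n false
  input : Fin n → Action n true
  bout  : Fin n → Action n true

wkᵇ : ∀ b → Proc n → Proc (n ⊕ b)
wkᵇ false P = P
wkᵇ true  P = wk P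

infix 4 _—[_]→_
data _—[_]→_ {n : ℕ} : Proc n → Action n b → Proc (n ⊕ b) → Set where
  t-out     : out x z P —[ fout x z ]→ P
  t-inp     : inp x P —[ input x ]→ P
  t-parˡ    : {a : Action n b} → P —[ a ]→ P′ → P ∣ Q —[ a ]→ P′ ∣ wkᵇ b Q
  t-parʳ    : {a : Action n b} → Q —[ a ]→ Q′ → P ∣ Q —[ a ]→ wkᵇ b P ∣ Q′
  t-commˡ   : P —[ fout x z ]→ P′ → Q —[ input x ]→ Q′ → P ∣ Q —[ τ ]→ P′ ∣ Q′ [ z ]
  t-commʳ   : P —[ input x ]→ P′ → Q —[ fout x z ]→ Q′ → P ∣ Q —[ τ ]→ P′ [ z ] ∣ Q′
  t-closeˡ  : P —[ bout x ]→ P′ → Q —[ input x ]→ Q′ → P ∣ Q —[ τ ]→ ν (P′ ∣ Q′)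
  t-closeʳ  : P —[ input x ]→ P′ → Q —[ bout x ]→ Q′ → P ∣ Q —[ τ ]→ ν (P′ ∣ Q′)
  t-resτ    : P —[ τ ]→ P′ → ν P —[ τ ]→ ν P′
  t-resout  : P —[ fout (suc x) (suc z) ]→ P′ → ν P —[ fout x z ]→ ν P′
  t-resinp  : P —[ input (suc x) ]→ P′ → ν P —[ input x ]→ ν (rename swapρ P′)
  t-resbout : P —[ bout (suc x) ]→ P′ → ν P —[ bout x ]→ ν (rename swapρ P′)
  t-open    : P —[ fout (suc x) zero ]→ P′ → ν P —[ bout x ]→ P′
  t-rep     : {a : Action n b} → P ∣ ! P —[ a ]→ P′ → ! P —[ a ]→ P′

renameᵃ : (Fin n → Fin m) → Action n b → Action m b
renameᵃ ρ τ          = τ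
renameᵃ ρ (fout x z) = fout (ρ x) (ρ z)
renameᵃ ρ (input x)  = input (ρ x)
renameᵃ ρ (bout x)   = bout (ρ x)

liftᵇ : ∀ b → (Fin n → Fin m) → Fin (n ⊕ b) → Fin (m ⊕ b)
liftᵇ false ρ = ρ
liftᵇ true  ρ = lift ρ

rename-wkᵇ : ∀ b (ρ : Fin n → Fin m) Q → rename (liftᵇ b ρ) (wkᵇ b Q) ≡ wkᵇ b (rename ρ Q)
rename-wkᵇ false ρ Q = refl
rename-wkᵇ true  ρ Q = rename-lift-wk ρ Q

retarget : {a : Action n b} {X Y : Proc (n ⊕ b)} → X ≡ Y → P —[ a ]→ X → P —[ a ]→ Y
retarget refl d = d

—→-rename : ∀ (ρ : Fin n → Fin m) {a : Action n b} → P —[ a ]→ P′ →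
            rename ρ P —[ renameᵃ ρ a ]→ rename (liftᵇ b ρ) P′
—→-rename ρ t-out = t-out
—→-rename ρ t-inp = t-inp
—→-rename ρ (t-parˡ {b} {Q = Q} d) =
  retarget (cong (_ ∣_) (sym (rename-wkᵇ b ρ Q))) (t-parˡ (—→-rename ρ d))
—→-rename ρ (t-parʳ {b} {P = P} d) =
  retarget (cong (_∣ _) (sym (rename-wkᵇ b ρ P))) (t-parʳ (—→-rename ρ d))
—→-rename ρ (t-commˡ {z = z} {Q′ = Q′} d e) =
  retarget (cong (_ ∣_) (sym (rename-[] ρ z Q′))) (t-commˡ (—→-rename ρ d) (—→-rename ρ e))
—→-rename ρ (t-commʳ {P′ = P′} {z = z} d e) =
  retarget (cong (_∣ _) (sym (rename-[] ρ z P′))) (t-commʳ (—→-rename ρ d) (—→-rename ρ e))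
—→-rename ρ (t-closeˡ d e) = t-closeˡ (—→-rename ρ d) (—→-rename ρ e)
—→-rename ρ (t-closeʳ d e) = t-closeʳ (—→-rename ρ d) (—→-rename ρ e)
—→-rename ρ (t-resτ d)     = t-resτ (—→-rename (lift ρ) d)
—→-rename ρ (t-resout d)   = t-resout (—→-rename (lift ρ) d)
—→-rename ρ (t-resinp {P′ = P′} d) =
  retarget (cong ν (sym (rename-swapρ-lift-lift ρ P′))) (t-resinp (—→-rename (lift ρ) d))
—→-rename ρ (t-resbout {P′ = P′} d) =
  retarget (cong ν (sym (rename-swapρ-lift-lift ρ P′))) (t-resbout (—→-rename (lift ρ) d))
—→-rename ρ (t-open d)     = t-open (—→-rename (lift ρ) d)
—→-rename ρ (t-rep d)      = t-rep (—→-rename ρ d)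

lift-injective : {ρ : Fin n → Fin m} → Injective _≡_ _≡_ ρ → Injective _≡_ _≡_ (lift ρ)
lift-injective inj {zero}  {zero}  _  = refl
lift-injective inj {suc i} {suc j} eq = cong suc (inj (suc-injective eq))

record Unrenamed (ρ : Fin n → Fin m) (P : Proc n) (a : Action m b) (X : Proc (m ⊕ b)) : Set where
  constructor unrenamed
  field
    {action} : Action n b
    {target} : Proc (n ⊕ b)
    action≡  : a ≡ renameᵃ ρ action
    step     : P —[ action ]→ target
    target≡  : X ≡ rename (liftᵇ b ρ) target

private
  input-injective : input x ≡ input y → x ≡ y
  input-injective refl = refl

  bout-injective : bout x ≡ bout y → x ≡ y
  bout-injective refl = refl

  fout-injectiveˡ : ∀ {z w : Fin n} → fout x z ≡ fout y w → x ≡ y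
  fout-injectiveˡ refl = refl

mutual
  —→-unrename : {ρ : Fin n → Fin m} → Injective _≡_ _≡_ ρ →
                ∀ P {a : Action m b} {X} → rename ρ P —[ a ]→ X → Unrenamed ρ P a X
  —→-unrename inj (out x z P) t-out = unrenamed refl t-out refl
  —→-unrename inj (inp x P)   t-inp = unrenamed refl t-inp refl
  —→-unrename {ρ = ρ} inj (P ∣ Q) (t-parˡ {b} d) with —→-unrename inj P d
  ... | unrenamed ea d₀ eX = unrenamed ea (t-parˡ d₀) (cong₂ _∣_ eX (sym (rename-wkᵇ b ρ Q)))
  —→-unrename {ρ = ρ} inj (P ∣ Q) (t-parʳ {b} d) with —→-unrename inj Q d
  ... | unrenamed ea d₀ eX = unrenamed ea (t-parʳ d₀) (cong₂ _∣_ (sym (rename-wkᵇ b ρ P)) eX)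
  —→-unrename {ρ = ρ} inj (P ∣ Q) (t-commˡ d e) with —→-unrename inj P d | —→-unrename inj Q e
  ... | unrenamed {fout x z} refl d₀ refl | unrenamed {input _} ea e₀ refl with inj (input-injective ea)
  ... | refl = unrenamed refl (t-commˡ d₀ e₀) (cong (_ ∣_) (sym (rename-[] ρ z _)))
  —→-unrename {ρ = ρ} inj (P ∣ Q) (t-commʳ d e) with —→-unrename inj P d | —→-unrename inj Q e
  ... | unrenamed {input x} refl d₀ refl | unrenamed {fout _ z} ea e₀ refl with inj (fout-injectiveˡ ea)
  ... | refl with ea
  ... | refl = unrenamed refl (t-commʳ d₀ e₀) (cong (_∣ _) (sym (rename-[] ρ z _)))
  —→-unrename inj (P ∣ Q) (t-closeˡ d e) with —→-unrename inj P d | —→-unrename inj Q e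
  ... | unrenamed {bout x} refl d₀ refl | unrenamed {input _} ea e₀ refl with inj (input-injective ea)
  ... | refl = unrenamed refl (t-closeˡ d₀ e₀) refl
  —→-unrename inj (P ∣ Q) (t-closeʳ d e) with —→-unrename inj P d | —→-unrename inj Q e
  ... | unrenamed {input x} refl d₀ refl | unrenamed {bout _} ea e₀ refl with inj (bout-injective ea)
  ... | refl = unrenamed refl (t-closeʳ d₀ e₀) refl
  —→-unrename inj (ν P) d = —→-unrename-ν inj P d
  —→-unrename inj (! P) (t-rep d) with —→-unrename inj (P ∣ ! P) d
  ... | unrenamed ea d₀ eX = unrenamed ea (t-rep d₀) eX

  —→-unrename-ν : {ρ : Fin n → Fin m} → Injective _≡_ _≡_ ρ →
                  ∀ P {a : Action m b} {X} → ν (rename (lift ρ) P) —[ a ]→ X → Unrenamed ρ (ν P) a X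
  —→-unrename-ν inj P (t-resτ d) with —→-unrename (lift-injective inj) P d
  ... | unrenamed {τ} refl d₀ refl = unrenamed refl (t-resτ d₀) refl
  —→-unrename-ν inj P (t-resout d) with —→-unrename (lift-injective inj) P d
  ... | unrenamed {fout (suc x) (suc z)} refl d₀ refl = unrenamed refl (t-resout d₀) refl
  ... | unrenamed {fout zero _} () _ _
  ... | unrenamed {fout (suc _) zero} () _ _
  —→-unrename-ν {ρ = ρ} inj P (t-resinp d) with —→-unrename (lift-injective inj) P d
  ... | unrenamed {input (suc x)} refl d₀ refl =
    unrenamed refl (t-resinp d₀) (cong ν (sym (rename-swapρ-lift-lift ρ _)))
  ... | unrenamed {input zero} () _ _
  —→-unrename-ν {ρ = ρ} inj P (t-resbout d) with —→-unrename (lift-injective inj) P d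
  ... | unrenamed {bout (suc x)} refl d₀ refl =
    unrenamed refl (t-resbout d₀) (cong ν (sym (rename-swapρ-lift-lift ρ _)))
  ... | unrenamed {bout zero} () _ _
  —→-unrename-ν inj P (t-open d) with —→-unrename (lift-injective inj) P d
  ... | unrenamed {fout (suc x) zero} refl d₀ refl = unrenamed refl (t-open d₀) refl
  ... | unrenamed {fout zero _} () _ _
  ... | unrenamed {fout (suc _) (suc _)} () _ _

-- Structural congruence is a strong bisimulation

infix 4 _≲_
_≲_ : Proc n → Proc n → Set
_≲_ {n} P Q = ∀ {b} {a : Action n b} {P′} → P —[ a ]→ P′ → ∃ λ Q′ → Q —[ a ]→ Q′ × P′ ≡ₛ Q′

≲-refl : P ≲ P
≲-refl d = _ , d , s-refl

≲-trans : P ≲ Q → Q ≲ R → P ≲ R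
≲-trans f g d with f d
... | _ , d′ , e with g d′
... | _ , d″ , e′ = _ , d″ , s-trans e e′

wkᵇ-≡ₛ : ∀ b → P ≡ₛ Q → wkᵇ b P ≡ₛ wkᵇ b Q
wkᵇ-≡ₛ false e = e
wkᵇ-≡ₛ true  e = rename-≡ₛ suc e

par-≲ : P ≡ₛ P′ → Q ≡ₛ Q′ → P ≲ P′ → Q ≲ Q′ → P ∣ Q ≲ P′ ∣ Q′
par-≲ eP eQ f g (t-parˡ {b} d) with f d
... | _ , d′ , e = _ , t-parˡ d′ , s-par e (wkᵇ-≡ₛ b eQ)
par-≲ eP eQ f g (t-parʳ {b} d) with g d
... | _ , d′ , e = _ , t-parʳ d′ , s-par (wkᵇ-≡ₛ b eP) e
par-≲ eP eQ f g (t-commˡ {z = z} d d′) with f d | g d′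
... | _ , c , e | _ , c′ , e′ = _ , t-commˡ c c′ , s-par e (rename-≡ₛ (substρ z) e′)
par-≲ eP eQ f g (t-commʳ {z = z} d d′) with f d | g d′
... | _ , c , e | _ , c′ , e′ = _ , t-commʳ c c′ , s-par (rename-≡ₛ (substρ z) e) e′
par-≲ eP eQ f g (t-closeˡ d d′) with f d | g d′
... | _ , c , e | _ , c′ , e′ = _ , t-closeˡ c c′ , s-res (s-par e e′)
par-≲ eP eQ f g (t-closeʳ d d′) with f d | g d′
... | _ , c , e | _ , c′ , e′ = _ , t-closeʳ c c′ , s-res (s-par e e′)

res-≲ : {P P′ : Proc (suc n)} → P ≲ P′ → ν P ≲ ν P′
res-≲ f (t-resτ d) with f d
... | _ , d′ , e = _ , t-resτ d′ , s-res e
res-≲ f (t-resout d) with f d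
... | _ , d′ , e = _ , t-resout d′ , s-res e
res-≲ f (t-resinp d) with f d
... | _ , d′ , e = _ , t-resinp d′ , s-res (rename-≡ₛ swapρ e)
res-≲ f (t-resbout d) with f d
... | _ , d′ , e = _ , t-resbout d′ , s-res (rename-≡ₛ swapρ e)
res-≲ f (t-open d) with f d
... | _ , d′ , e = _ , t-open d′ , e

-- P ∣ ! P is not structurally smaller than ! P, so par-≲ cannot be reused: the
-- recursion is on the derivation.
mutual
  rep-≲ : P ≡ₛ P′ → P ≲ P′ → ! P ≲ ! P′
  rep-≲ eP f (t-rep d) with unfolded-≲ eP f d
  ... | _ , d′ , e = _ , t-rep d′ , e

  unfolded-≲ : P ≡ₛ P′ → P ≲ P′ → P ∣ ! P ≲ P′ ∣ ! P′
  unfolded-≲ eP f (t-parˡ {b} d) with f d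
  ... | _ , d′ , e = _ , t-parˡ d′ , s-par e (wkᵇ-≡ₛ b (s-rep eP))
  unfolded-≲ eP f (t-parʳ {b} d) with rep-≲ eP f d
  ... | _ , d′ , e = _ , t-parʳ d′ , s-par (wkᵇ-≡ₛ b eP) e
  unfolded-≲ eP f (t-commˡ {z = z} d d′) with f d | rep-≲ eP f d′
  ... | _ , c , e | _ , c′ , e′ = _ , t-commˡ c c′ , s-par e (rename-≡ₛ (substρ z) e′)
  unfolded-≲ eP f (t-commʳ {z = z} d d′) with f d | rep-≲ eP f d′
  ... | _ , c , e | _ , c′ , e′ = _ , t-commʳ c c′ , s-par (rename-≡ₛ (substρ z) e) e′
  unfolded-≲ eP f (t-closeˡ d d′) with f d | rep-≲ eP f d′
  ... | _ , c , e | _ , c′ , e′ = _ , t-closeˡ c c′ , s-res (s-par e e′)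
  unfolded-≲ eP f (t-closeʳ d d′) with f d | rep-≲ eP f d′
  ... | _ , c , e | _ , c′ , e′ = _ , t-closeʳ c c′ , s-res (s-par e e′)

par-unit-≲ : P ∣ 𝟘 ≲ P
par-unit-≲ (t-parˡ {false} d) = _ , d , par-unit
par-unit-≲ (t-parˡ {true}  d) = _ , d , par-unit

par-unit-≳ : P ≲ P ∣ 𝟘
par-unit-≳ {b = false} d = _ , t-parˡ d , s-sym par-unit
par-unit-≳ {b = true}  d = _ , t-parˡ d , s-sym par-unit

par-comm-≲ : P ∣ Q ≲ Q ∣ P
par-comm-≲ (t-parˡ d)      = _ , t-parʳ d , par-comm
par-comm-≲ (t-parʳ d)      = _ , t-parˡ d , par-comm
par-comm-≲ (t-commˡ d e)   = _ , t-commʳ e d , par-comm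
par-comm-≲ (t-commʳ d e)   = _ , t-commˡ e d , par-comm
par-comm-≲ (t-closeˡ d e)  = _ , t-closeʳ e d , s-res par-comm
par-comm-≲ (t-closeʳ d e)  = _ , t-closeˡ e d , s-res par-comm

wkᵇ-par : ∀ b (Q R : Proc n) → wkᵇ b (Q ∣ R) ≡ (wkᵇ b Q ∣ wkᵇ b R)
wkᵇ-par false Q R = refl
wkᵇ-par true  Q R = refl

par-assoc-≲ : (P ∣ Q) ∣ R ≲ P ∣ (Q ∣ R)
par-assoc-≲ {Q = Q} {R = R} (t-parˡ {b} (t-parˡ d)) =
  _ , t-parˡ d , s-trans par-assoc (≡⇒≡ₛ (cong (_ ∣_) (sym (wkᵇ-par b Q R))))
par-assoc-≲ (t-parˡ (t-parʳ d)) = _ , t-parʳ (t-parˡ d) , par-assoc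
par-assoc-≲ {R = R} (t-parˡ (t-commˡ {z = z} d e)) =
  _ , t-commˡ d (t-parˡ e) , s-trans par-assoc (parʳ-≡ₛ (parʳ-≡ₛ (≡⇒≡ₛ (sym (wk-[] z R)))))
par-assoc-≲ (t-parˡ (t-commʳ d e))  = _ , t-commʳ d (t-parˡ e) , par-assoc
par-assoc-≲ (t-parˡ (t-closeˡ d e)) = _ , t-closeˡ d (t-parˡ e) , s-trans (s-sym res-extrʳ) (s-res par-assoc)
par-assoc-≲ (t-parˡ (t-closeʳ d e)) = _ , t-closeʳ d (t-parˡ e) , s-trans (s-sym res-extrʳ) (s-res par-assoc)
par-assoc-≲ {P = P} {Q = Q} (t-parʳ {b} d) =
  _ , t-parʳ (t-parʳ d) , s-trans (parˡ-≡ₛ (≡⇒≡ₛ (wkᵇ-par b P Q))) par-assoc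
par-assoc-≲ {Q = Q} (t-commˡ {z = z} (t-parˡ d) e) =
  _ , t-commˡ d (t-parʳ e) , s-trans par-assoc (parʳ-≡ₛ (parˡ-≡ₛ (≡⇒≡ₛ (sym (wk-[] z Q)))))
par-assoc-≲ (t-commˡ (t-parʳ d) e) = _ , t-parʳ (t-commˡ d e) , par-assoc
par-assoc-≲ {Q = Q} (t-commʳ {z = z} (t-parˡ d) e) =
  _ , t-commʳ d (t-parʳ e) , s-trans par-assoc (parʳ-≡ₛ (parˡ-≡ₛ (≡⇒≡ₛ (wk-[] z Q))))
par-assoc-≲ {P = P} (t-commʳ {z = z} (t-parʳ d) e) =
  _ , t-parʳ (t-commʳ d e) , s-trans par-assoc (parˡ-≡ₛ (≡⇒≡ₛ (wk-[] z P)))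
par-assoc-≲ (t-closeˡ (t-parˡ d) e) = _ , t-closeˡ d (t-parʳ e) , s-res par-assoc
par-assoc-≲ (t-closeˡ (t-parʳ d) e) = _ , t-parʳ (t-closeˡ d e) , s-trans (s-res par-assoc) res-extr
par-assoc-≲ (t-closeʳ (t-parˡ d) e) = _ , t-closeʳ d (t-parʳ e) , s-res par-assoc
par-assoc-≲ (t-closeʳ (t-parʳ d) e) = _ , t-parʳ (t-closeʳ d e) , s-trans (s-res par-assoc) res-extr

par-assoc-≳ : P ∣ (Q ∣ R) ≲ (P ∣ Q) ∣ R
par-assoc-≳ = ≲-trans par-comm-≲ (≲-trans par-assoc-≲ (≲-trans par-comm-≲ (≲-trans par-assoc-≲ par-comm-≲)))

rep-unf-≲ : ! P ≲ P ∣ ! P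
rep-unf-≲ (t-rep d) = _ , d , s-refl

rep-unf-≳ : P ∣ ! P ≲ ! P
rep-unf-≳ d = _ , t-rep d , s-refl

res-nil-≲ : ν 𝟘 ≲ 𝟘 {n}
res-nil-≲ (t-resτ ())
res-nil-≲ (t-resout ())
res-nil-≲ (t-resinp ())
res-nil-≲ (t-resbout ())
res-nil-≲ (t-open ())

res-nil-≳ : 𝟘 ≲ ν (𝟘 {suc n})
res-nil-≳ ()

swapρ-braid : ∀ (i : Fin (suc (suc (suc n)))) →
              swapρ (lift swapρ (swapρ i)) ≡ lift swapρ (swapρ (lift swapρ i))
swapρ-braid zero                = refl
swapρ-braid (suc zero)          = refl
swapρ-braid (suc (suc zero))    = refl
swapρ-braid (suc (suc (suc i))) = refl

rename-swapρ-braid : ∀ (P : Proc (suc (suc (suc n)))) →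
  rename swapρ (rename (lift swapρ) (rename swapρ P)) ≡
  rename (lift swapρ) (rename swapρ (rename (lift swapρ) P))
rename-swapρ-braid P =
  trans (cong (rename swapρ) (rename-fuse (λ _ → refl) P))
        (trans (rename-square swapρ-braid P)
               (sym (cong (rename (lift swapρ)) (rename-fuse (λ _ → refl) P))))

res-swap-≲ : {P : Proc (suc (suc n))} → ν (ν P) ≲ ν (ν (rename swapρ P))
res-swap-≲ (t-resτ (t-resτ d)) = _ , t-resτ (t-resτ (—→-rename swapρ d)) , res-swap
res-swap-≲ (t-resout (t-resout d)) = _ , t-resout (t-resout (—→-rename swapρ d)) , res-swap
res-swap-≲ (t-resinp (t-resinp {P′ = P′} d)) =
  _ , t-resinp (t-resinp (—→-rename swapρ d)) ,
  s-trans res-swap (s-res (s-res (≡⇒≡ₛ (rename-swapρ-braid P′))))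
res-swap-≲ (t-resbout (t-resbout {P′ = P′} d)) =
  _ , t-resbout (t-resbout (—→-rename swapρ d)) ,
  s-trans res-swap (s-res (s-res (≡⇒≡ₛ (rename-swapρ-braid P′))))
res-swap-≲ (t-resbout (t-open d)) = _ , t-open (t-resout (—→-rename swapρ d)) , s-refl
res-swap-≲ (t-open (t-resout {P′ = P′} d)) =
  _ , t-resbout (t-open (—→-rename swapρ d)) , s-res (≡⇒≡ₛ (sym (rename-swapρ-involutive P′)))

res-swap-≳ : {P : Proc (suc (suc n))} → ν (ν (rename swapρ P)) ≲ ν (ν P)
res-swap-≳ {P = P} = subst (λ W → ν (ν (rename swapρ P)) ≲ ν (ν W)) (rename-swapρ-involutive P) res-swap-≲

res-lift-suc-swap : ∀ (P : Proc (suc n)) Q →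
  ν (ν (rename (lift suc) P ∣ Q)) ≡ₛ ν (P ∣ ν (rename swapρ Q))
res-lift-suc-swap P Q =
  s-trans res-swap (s-res (s-trans (s-res (parˡ-≡ₛ (≡⇒≡ₛ (rename-fuse swapρ-lift-suc P)))) res-extr))

res-swapρ-extrˡ : ∀ (P : Proc (suc n)) Q →
  ν (rename swapρ (rename (lift suc) P ∣ wk Q)) ≡ₛ (P ∣ ν (rename (lift suc) Q))
res-swapρ-extrˡ P Q =
  s-trans (s-res (s-par (≡⇒≡ₛ (rename-fuse swapρ-lift-suc P)) (≡⇒≡ₛ (rename-fuse swapρ-suc Q)))) res-extr

res-swapρ-extrʳ : ∀ (P : Proc n) Q →
  ν (rename swapρ (wk (wk P) ∣ Q)) ≡ₛ (wk P ∣ ν (rename swapρ Q))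
res-swapρ-extrʳ P Q =
  s-trans (s-res (parˡ-≡ₛ (≡⇒≡ₛ (trans (cong (rename swapρ) (rename-fuse (λ _ → refl) P))
                                              (rename-square (λ _ → refl) P)))))
          res-extr

res-extr-≲ : ν (wk P ∣ Q) ≲ P ∣ ν Q
res-extr-≲ {P = P} (t-resτ (t-parˡ d)) with —→-unrename suc-injective P d
... | unrenamed {τ} refl d₀ refl = _ , t-parˡ d₀ , res-extr
res-extr-≲ (t-resτ (t-parʳ d)) = _ , t-parʳ (t-resτ d) , res-extr
res-extr-≲ {P = P} (t-resτ (t-commˡ d e)) with —→-unrename suc-injective P d
... | unrenamed {fout x z} refl d₀ refl =
  _ , t-commˡ d₀ (t-resinp e) , s-trans res-extr (parʳ-≡ₛ (≡⇒≡ₛ (res-[] z _)))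
res-extr-≲ {P = P} (t-resτ (t-commʳ {z = zero} d e)) with —→-unrename suc-injective P d
... | unrenamed {input x} refl d₀ refl =
  _ , t-closeʳ d₀ (t-open e) , s-res (parˡ-≡ₛ (≡⇒≡ₛ (lift-suc-[zero] _)))
res-extr-≲ {P = P} (t-resτ (t-commʳ {z = suc z} d e)) with —→-unrename suc-injective P d
... | unrenamed {input x} refl d₀ refl =
  _ , t-commʳ d₀ (t-resout e) , s-trans (s-res (parˡ-≡ₛ (≡⇒≡ₛ (lift-suc-[suc] z _)))) res-extr
res-extr-≲ {P = P} (t-resτ (t-closeˡ d e)) with —→-unrename suc-injective P d
... | unrenamed {bout x} refl d₀ refl = _ , t-closeˡ d₀ (t-resinp e) , res-lift-suc-swap _ _
res-extr-≲ {P = P} (t-resτ (t-closeʳ d e)) with —→-unrename suc-injective P d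
... | unrenamed {input x} refl d₀ refl = _ , t-closeʳ d₀ (t-resbout e) , res-lift-suc-swap _ _
res-extr-≲ {P = P} (t-resout (t-parˡ d)) with —→-unrename suc-injective P d
... | unrenamed {fout x z} refl d₀ refl = _ , t-parˡ d₀ , res-extr
res-extr-≲ (t-resout (t-parʳ d)) = _ , t-parʳ (t-resout d) , res-extr
res-extr-≲ {P = P} {Q = Q} (t-resinp (t-parˡ d)) with —→-unrename suc-injective P d
... | unrenamed {input x} refl d₀ refl = _ , t-parˡ d₀ , res-swapρ-extrˡ _ Q
res-extr-≲ {P = P} (t-resinp (t-parʳ d)) = _ , t-parʳ (t-resinp d) , res-swapρ-extrʳ P _
res-extr-≲ {P = P} {Q = Q} (t-resbout (t-parˡ d)) with —→-unrename suc-injective P d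
... | unrenamed {bout x} refl d₀ refl = _ , t-parˡ d₀ , res-swapρ-extrˡ _ Q
res-extr-≲ {P = P} (t-resbout (t-parʳ d)) = _ , t-parʳ (t-resbout d) , res-swapρ-extrʳ P _
res-extr-≲ {P = P} (t-open (t-parˡ d)) with —→-unrename suc-injective P d
... | unrenamed {fout x zero} () _ _
... | unrenamed {fout x (suc z)} () _ _
res-extr-≲ (t-open (t-parʳ d)) = _ , t-parʳ (t-open d) , s-refl

res-extr-≳ : P ∣ ν Q ≲ ν (wk P ∣ Q)
res-extr-≳ (t-parˡ {a = τ} d)      = _ , t-resτ (t-parˡ (—→-rename suc d)) , s-sym res-extr
res-extr-≳ (t-parˡ {a = fout x z} d) = _ , t-resout (t-parˡ (—→-rename suc d)) , s-sym res-extr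
res-extr-≳ {Q = Q} (t-parˡ {P′ = P′} {a = input x} d) =
  _ , t-resinp (t-parˡ (—→-rename suc d)) , s-sym (res-swapρ-extrˡ P′ Q)
res-extr-≳ {Q = Q} (t-parˡ {P′ = P′} {a = bout x} d) =
  _ , t-resbout (t-parˡ (—→-rename suc d)) , s-sym (res-swapρ-extrˡ P′ Q)
res-extr-≳ (t-parʳ (t-resτ d))   = _ , t-resτ (t-parʳ d) , s-sym res-extr
res-extr-≳ (t-parʳ (t-resout d)) = _ , t-resout (t-parʳ d) , s-sym res-extr
res-extr-≳ {P = P} (t-parʳ (t-resinp d))  = _ , t-resinp (t-parʳ d) , s-sym (res-swapρ-extrʳ P _)
res-extr-≳ {P = P} (t-parʳ (t-resbout d)) = _ , t-resbout (t-parʳ d) , s-sym (res-swapρ-extrʳ P _)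
res-extr-≳ (t-parʳ (t-open d)) = _ , t-open (t-parʳ d) , s-refl
res-extr-≳ (t-commˡ {z = z} d (t-resinp e)) =
  _ , t-resτ (t-commˡ (—→-rename suc d) e) , s-sym (s-trans res-extr (parʳ-≡ₛ (≡⇒≡ₛ (res-[] z _))))
res-extr-≳ (t-commʳ {P′ = P′} {z = z} d (t-resout e)) =
  _ , t-resτ (t-commʳ (—→-rename suc d) e) ,
  s-sym (s-trans (s-res (parˡ-≡ₛ (≡⇒≡ₛ (lift-suc-[suc] z P′)))) res-extr)
res-extr-≳ (t-closeˡ {P′ = P′} d (t-resinp e)) =
  _ , t-resτ (t-closeˡ (—→-rename suc d) e) , s-sym (res-lift-suc-swap P′ _)
res-extr-≳ (t-closeʳ {P′ = P′} d (t-resbout e)) =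
  _ , t-resτ (t-closeʳ (—→-rename suc d) e) , s-sym (res-lift-suc-swap P′ _)
res-extr-≳ (t-closeʳ {P′ = P′} d (t-open e)) =
  _ , t-resτ (t-commʳ (—→-rename suc d) e) , s-sym (s-res (parˡ-≡ₛ (≡⇒≡ₛ (lift-suc-[zero] P′))))

≡ₛ⇒≲×≳ : P ≡ₛ Q → P ≲ Q × Q ≲ P
≡ₛ⇒≲×≳ s-refl = ≲-refl , ≲-refl
≡ₛ⇒≲×≳ (s-sym e) with ≡ₛ⇒≲×≳ e
... | f , g = g , f
≡ₛ⇒≲×≳ (s-trans e e′) with ≡ₛ⇒≲×≳ e | ≡ₛ⇒≲×≳ e′
... | f , g | f′ , g′ = ≲-trans f f′ , ≲-trans g′ g
≡ₛ⇒≲×≳ (s-out e) = (λ { t-out → _ , t-out , e }) , (λ { t-out → _ , t-out , s-sym e })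
≡ₛ⇒≲×≳ (s-inp e) = (λ { t-inp → _ , t-inp , e }) , (λ { t-inp → _ , t-inp , s-sym e })
≡ₛ⇒≲×≳ (s-par e e′) with ≡ₛ⇒≲×≳ e | ≡ₛ⇒≲×≳ e′
... | f , g | f′ , g′ = par-≲ e e′ f f′ , par-≲ (s-sym e) (s-sym e′) g g′
≡ₛ⇒≲×≳ (s-res e) with ≡ₛ⇒≲×≳ e
... | f , g = res-≲ f , res-≲ g
≡ₛ⇒≲×≳ (s-rep e) with ≡ₛ⇒≲×≳ e
... | f , g = rep-≲ e f , rep-≲ (s-sym e) g
≡ₛ⇒≲×≳ par-unit  = par-unit-≲ , par-unit-≳
≡ₛ⇒≲×≳ par-comm  = par-comm-≲ , par-comm-≲
≡ₛ⇒≲×≳ par-assoc = par-assoc-≲ , par-assoc-≳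
≡ₛ⇒≲×≳ rep-unf   = rep-unf-≲ , rep-unf-≳
≡ₛ⇒≲×≳ res-nil   = res-nil-≲ , res-nil-≳
≡ₛ⇒≲×≳ res-swap  = res-swap-≲ , res-swap-≳
≡ₛ⇒≲×≳ res-extr  = res-extr-≲ , res-extr-≳

⟶⇒τ : P ⟶ Q → ∃ λ Q′ → P —[ τ ]→ Q′ × Q′ ≡ₛ Q
⟶⇒τ r-comm = _ , t-commˡ t-out t-inp , s-refl
⟶⇒τ (r-par r) with ⟶⇒τ r
... | _ , d , e = _ , t-parˡ d , parˡ-≡ₛ e
⟶⇒τ (r-res r) with ⟶⇒τ r
... | _ , d , e = _ , t-resτ d , s-res e
⟶⇒τ (r-struct e₁ r e₂) with ⟶⇒τ r
... | _ , d , e with proj₂ (≡ₛ⇒≲×≳ e₁) d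
... | _ , d′ , e′ = _ , d′ , s-trans (s-sym e′) (s-trans e e₂)

⟶-parʳ : Q ⟶ Q′ → P ∣ Q ⟶ P ∣ Q′
⟶-parʳ r = r-struct par-comm (r-par r) par-comm

infix 4 _⟶*ₛ_
_⟶*ₛ_ : Proc n → Proc n → Set
P ⟶*ₛ Q = ∃ λ P′ → P ⟶* P′ × P′ ≡ₛ Q

≡ₛ⇒⟶*ₛ : P ≡ₛ Q → P ⟶*ₛ Q
≡ₛ⇒⟶*ₛ e = _ , ε , e

⟶*⇒⟶*ₛ : P ⟶* Q → P ⟶*ₛ Q
⟶*⇒⟶*ₛ rs = _ , rs , s-refl

≡ₛ-⟶*ₛ : P ≡ₛ P′ → P′ ⟶*ₛ Q → P ⟶*ₛ Q
≡ₛ-⟶*ₛ e (_ , ε , e′)      = _ , ε , s-trans e e′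
≡ₛ-⟶*ₛ e (_ , r ◅ rs , e′) = _ , r-struct e r s-refl ◅ rs , e′

⟶*ₛ-trans : P ⟶*ₛ Q → Q ⟶*ₛ R → P ⟶*ₛ R
⟶*ₛ-trans (_ , rs , e) q with ≡ₛ-⟶*ₛ e q
... | _ , rs′ , e′ = _ , rs ◅◅ rs′ , e′

⟶*ₛ-par : P ⟶*ₛ P′ → Q ⟶*ₛ Q′ → P ∣ Q ⟶*ₛ P′ ∣ Q′
⟶*ₛ-par (_ , rs , e) (_ , rs′ , e′) =
  _ , gmap (_∣ _) r-par rs ◅◅ gmap (_ ∣_) ⟶-parʳ rs′ , s-par e e′

⟶*ₛ-res : {P Q : Proc (suc n)} → P ⟶*ₛ Q → ν P ⟶*ₛ ν Q
⟶*ₛ-res (_ , rs , e) = _ , gmap ν r-res rs , s-res e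

rename-success : ∀ (ρ : Fin n → Fin m) → HasSuccess P → HasSuccess (rename ρ P)
rename-success ρ succ-√         = succ-√
rename-success ρ (succ-parˡ h) = succ-parˡ (rename-success ρ h)
rename-success ρ (succ-parʳ h) = succ-parʳ (rename-success ρ h)
rename-success ρ (succ-res h)  = succ-res (rename-success (lift ρ) h)
rename-success ρ (succ-rep h)  = succ-rep (rename-success ρ h)

rename-success⁻¹ : ∀ (ρ : Fin n → Fin m) P → HasSuccess (rename ρ P) → HasSuccess P
rename-success⁻¹ ρ (P ∣ Q) (succ-parˡ h) = succ-parˡ (rename-success⁻¹ ρ P h)
rename-success⁻¹ ρ (P ∣ Q) (succ-parʳ h) = succ-parʳ (rename-success⁻¹ ρ Q h)
rename-success⁻¹ ρ (ν P)   (succ-res h)  = succ-res (rename-success⁻¹ (lift ρ) P h)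
rename-success⁻¹ ρ (! P)   (succ-rep h)  = succ-rep (rename-success⁻¹ ρ P h)
rename-success⁻¹ ρ √       succ-√        = succ-√

≡ₛ-success : P ≡ₛ Q → HasSuccess P ⇔ HasSuccess Q
≡ₛ-success s-refl        = ⇔.refl
≡ₛ-success (s-sym e)     = ⇔.sym (≡ₛ-success e)
≡ₛ-success (s-trans e f) = ⇔.trans (≡ₛ-success e) (≡ₛ-success f)
≡ₛ-success (s-out e)     = mk⇔ (λ ()) (λ ())
≡ₛ-success (s-inp e)     = mk⇔ (λ ()) (λ ())
≡ₛ-success (s-par e f)   = mk⇔
  (λ { (succ-parˡ h) → succ-parˡ (to h) ; (succ-parʳ h) → succ-parʳ (to′ h) })
  (λ { (succ-parˡ h) → succ-parˡ (from h) ; (succ-parʳ h) → succ-parʳ (from′ h) })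
  where
  open Equivalence (≡ₛ-success e)
  open Equivalence (≡ₛ-success f) renaming (to to to′; from to from′)
≡ₛ-success (s-res e) = mk⇔ (λ { (succ-res h) → succ-res (to h) }) (λ { (succ-res h) → succ-res (from h) })
  where open Equivalence (≡ₛ-success e)
≡ₛ-success (s-rep e) = mk⇔ (λ { (succ-rep h) → succ-rep (to h) }) (λ { (succ-rep h) → succ-rep (from h) })
  where open Equivalence (≡ₛ-success e)
≡ₛ-success par-unit = mk⇔ (λ { (succ-parˡ h) → h ; (succ-parʳ ()) }) succ-parˡ
≡ₛ-success par-comm = mk⇔ swap swap
  where
  swap : HasSuccess (P ∣ Q) → HasSuccess (Q ∣ P)
  swap (succ-parˡ h) = succ-parʳ h
  swap (succ-parʳ h) = succ-parˡ h
≡ₛ-success par-assoc = mk⇔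
  (λ { (succ-parˡ (succ-parˡ h)) → succ-parˡ h
     ; (succ-parˡ (succ-parʳ h)) → succ-parʳ (succ-parˡ h)
     ; (succ-parʳ h)             → succ-parʳ (succ-parʳ h) })
  (λ { (succ-parˡ h)             → succ-parˡ (succ-parˡ h)
     ; (succ-parʳ (succ-parˡ h)) → succ-parˡ (succ-parʳ h)
     ; (succ-parʳ (succ-parʳ h)) → succ-parʳ h })
≡ₛ-success rep-unf = mk⇔ (λ { (succ-rep h) → succ-parˡ h }) (λ { (succ-parˡ h) → succ-rep h ; (succ-parʳ h) → h })
≡ₛ-success res-nil = mk⇔ (λ { (succ-res ()) }) (λ ())
≡ₛ-success res-swap = mk⇔
  (λ { (succ-res (succ-res h)) → succ-res (succ-res (rename-success swapρ h)) })
  (λ { (succ-res (succ-res h)) → succ-res (succ-res (rename-success⁻¹ swapρ _ h)) })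
≡ₛ-success (res-extr {P = P}) = mk⇔
  (λ { (succ-res (succ-parˡ h)) → succ-parˡ (rename-success⁻¹ suc P h)
     ; (succ-res (succ-parʳ h)) → succ-parʳ (succ-res h) })
  (λ { (succ-parˡ h)            → succ-res (succ-parˡ (rename-success suc h))
     ; (succ-parʳ (succ-res h)) → succ-res (succ-parʳ h) })

≡ₛ-success→ : P ≡ₛ Q → HasSuccess P → HasSuccess Q
≡ₛ-success→ e = Equivalence.to (≡ₛ-success e)

-- Validity from an operational correspondence

-- enc E is a partially executed translation and dec E the source process it stands for.
record Correspondence (T : ∀ {n} → Proc n → Proc n) : Set₁ where
  field
    State         : ℕ → Set
    enc dec       : ∀ {n} → State n → Proc n
    init          : ∀ {n} → Proc n → State n
    enc-init      : ∀ {n} (P : Proc n) → enc (init P) ≡ₛ T P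
    dec-init      : ∀ {n} (P : Proc n) → dec (init P) ≡ₛ P
    reflect       : ∀ {n} (E : State n) {X} → enc E ⟶ X →
                    ∃ λ E′ → X ≡ₛ enc E′ × (dec E ⟶ dec E′ ⊎ dec E ≡ₛ dec E′)
    settle        : ∀ {n} (E : State n) → enc E ⟶*ₛ T (dec E)
    simulate      : ∀ {n} {P P′ : Proc n} → P ⟶ P′ → T P ⟶*ₛ T P′
    success       : ∀ {n} {P : Proc n} → HasSuccess P → HasSuccess (T P)
    enc-success⁻¹ : ∀ {n} (E : State n) → HasSuccess (enc E) → HasSuccess (dec E)

module _ {T : ∀ {n} → Proc n → Proc n} (C : Correspondence T) where
  open Correspondence C

  private
    variable
      A A′ B : Proc n

  Related : Rel (Proc n) 0ℓ
  Related A B = ∃ λ E → A ≡ₛ enc E × B ≡ₛ dec E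

  Related± : Rel (Proc n) 0ℓ
  Related± A B = Related A B ⊎ Related B A

  related-step : Related A B → A ⟶ A′ → ∃ λ B′ → B ⟶* B′ × Related A′ B′
  related-step (E , eA , eB) r with reflect E (r-struct (s-sym eA) r s-refl)
  ... | E′ , eX , inj₁ r′ = _ , r-struct eB r′ s-refl ◅ ε , E′ , eX , s-refl
  ... | E′ , eX , inj₂ e′ = _ , ε , E′ , eX , s-trans eB e′

  related⁻¹-step : Related B A → A ⟶ A′ → ∃ λ B′ → B ⟶* B′ × Related B′ A′
  related⁻¹-step {A′ = A′} (E , eB , eA) r
    with ⟶*ₛ-trans (≡ₛ-⟶*ₛ eB (settle E)) (simulate (r-struct (s-sym eA) r s-refl))
  ... | _ , rs , e = _ , rs , init A′ , s-trans e (s-sym (enc-init A′)) , s-sym (dec-init A′)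

  related-success : Related A B → HasSuccess A → WeaklyHasSuccess B
  related-success (E , eA , eB) h = _ , ε , ≡ₛ-success→ (s-sym eB) (enc-success⁻¹ E (≡ₛ-success→ eA h))

  related⁻¹-success : Related B A → HasSuccess A → WeaklyHasSuccess B
  related⁻¹-success (E , eB , eA) h with ≡ₛ-⟶*ₛ eB (settle E)
  ... | _ , rs , e = _ , rs , ≡ₛ-success→ (s-sym e) (success (≡ₛ-success→ eA h))

  Related±-step : Related± A B → A ⟶ A′ → ∃ λ B′ → B ⟶* B′ × Related± A′ B′
  Related±-step (inj₁ p) r with related-step p r
  ... | _ , rs , q = _ , rs , inj₁ q
  Related±-step (inj₂ p) r with related⁻¹-step p r
  ... | _ , rs , q = _ , rs , inj₂ q

  Related±-success : Related± A B → HasSuccess A → WeaklyHasSuccess B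
  Related±-success (inj₁ p) = related-success p
  Related±-success (inj₂ p) = related⁻¹-success p

  Related±-isBisim : IsSRWRBisim {n} Related±
  Related±-isBisim = record
    { symm    = λ { (inj₁ p) → inj₂ p ; (inj₂ p) → inj₁ p }
    ; success = Related±-success
    ; step    = Related±-step
    }

  valid : ∀ (P : Proc n) → T P ≈ P
  valid P = Related± , Related±-isBisim , inj₁ (init P , s-sym (enc-init P) , s-sym (dec-init P))

data Silent {n : ℕ} : Action n b → Set where
  silent : Silent τ

fresh-output-binds : {S : Proc (suc (suc n))} {a : Action n b} →
                     ν (aout (suc x) zero ∣ inp zero S) —[ a ]→ X → b ≡ true
fresh-output-binds (t-resbout _) = refl
fresh-output-binds (t-resinp _)  = refl
fresh-output-binds (t-open _)    = refl
fresh-output-binds (t-resτ (t-commˡ t-out ()))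
fresh-output-binds (t-resout (t-parˡ ()))
fresh-output-binds (t-resout (t-parʳ ()))

fresh-output-unsuccessful : {S : Proc (suc (suc n))} → ¬ HasSuccess (ν (aout (suc x) zero ∣ inp zero S))
fresh-output-unsuccessful (succ-res (succ-parˡ ()))
fresh-output-unsuccessful (succ-res (succ-parʳ ()))

-- ⟦out⟧ x z R and ⟦inp⟧ x S translate x̄z.P and x(y).Q from R = ⟦P⟧ and S = ⟦Q⟧.
record PrefixEncoding : Set₁ where
  field
    ⟦out⟧ : Fin n → Fin n → Proc n → Proc n
    ⟦inp⟧ : Fin n → Proc (suc n) → Proc n
    ⟦out⟧-rename : ∀ (ρ : Fin n → Fin m) x z R → ⟦out⟧ (ρ x) (ρ z) (rename ρ R) ≡ rename ρ (⟦out⟧ x z R)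
    ⟦inp⟧-rename : ∀ (ρ : Fin n → Fin m) x S → ⟦inp⟧ (ρ x) (rename (lift ρ) S) ≡ rename ρ (⟦inp⟧ x S)
    ⟦out⟧-≡ₛ : R ≡ₛ R′ → ⟦out⟧ x z R ≡ₛ ⟦out⟧ x z R′
    ⟦inp⟧-≡ₛ : S ≡ₛ S′ → ⟦inp⟧ x S ≡ₛ ⟦inp⟧ x S′
    ⟦out⟧-unsuccessful : ¬ HasSuccess (⟦out⟧ x z R)
    ⟦inp⟧-unsuccessful : ¬ HasSuccess (⟦inp⟧ x S)
    ⟦out⟧-binds : {a : Action n b} → ⟦out⟧ x z R —[ a ]→ X → b ≡ true
    ⟦inp⟧-binds : {a : Action n b} → ⟦inp⟧ x S —[ a ]→ X → b ≡ true

-- Encoding-specific administrative states, besides the delivery shared by both encodings.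
record Blocks : Set₁ where
  field
    Block       : ℕ → Set
    encB decB   : Block n → Proc n
    renameB     : (Fin n → Fin m) → Block n → Block m
    encB-rename : ∀ (ρ : Fin n → Fin m) B → encB (renameB ρ B) ≡ rename ρ (encB B)
    decB-rename : ∀ (ρ : Fin n → Fin m) B → decB (renameB ρ B) ≡ rename ρ (decB B)
    encB-unsuccessful : ∀ (B : Block n) → ¬ HasSuccess (encB B)
    encB-silent : ∀ (B : Block n) {a : Action n b} → encB B —[ a ]→ X → Silent a

noBlocks : Blocks
noBlocks = record
  { Block             = λ _ → ⊥
  ; encB              = λ ()
  ; decB              = λ ()
  ; renameB           = λ _ ()
  ; encB-rename       = λ _ ()
  ; decB-rename       = λ _ ()
  ; encB-unsuccessful = λ ()
  ; encB-silent       = λ ()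
  }

module Compositional (E : PrefixEncoding) where
  open PrefixEncoding E

  ⟦_⟧ : Proc n → Proc n
  ⟦ 𝟘 ⟧         = 𝟘
  ⟦ out x z P ⟧ = ⟦out⟧ x z ⟦ P ⟧
  ⟦ inp x P ⟧   = ⟦inp⟧ x ⟦ P ⟧
  ⟦ P ∣ Q ⟧     = ⟦ P ⟧ ∣ ⟦ Q ⟧
  ⟦ ν P ⟧       = ν ⟦ P ⟧
  ⟦ ! P ⟧       = ! ⟦ P ⟧
  ⟦ √ ⟧         = √

  ⟦⟧-rename : ∀ (ρ : Fin n → Fin m) P → ⟦ rename ρ P ⟧ ≡ rename ρ ⟦ P ⟧
  ⟦⟧-rename ρ 𝟘           = refl
  ⟦⟧-rename ρ (out x z P) = trans (cong (⟦out⟧ (ρ x) (ρ z)) (⟦⟧-rename ρ P)) (⟦out⟧-rename ρ x z ⟦ P ⟧)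
  ⟦⟧-rename ρ (inp x P)   = trans (cong (⟦inp⟧ (ρ x)) (⟦⟧-rename (lift ρ) P)) (⟦inp⟧-rename ρ x ⟦ P ⟧)
  ⟦⟧-rename ρ (P ∣ Q)     = cong₂ _∣_ (⟦⟧-rename ρ P) (⟦⟧-rename ρ Q)
  ⟦⟧-rename ρ (ν P)       = cong ν (⟦⟧-rename (lift ρ) P)
  ⟦⟧-rename ρ (! P)       = cong !_ (⟦⟧-rename ρ P)
  ⟦⟧-rename ρ √           = refl

  ⟦⟧-≡ₛ : P ≡ₛ Q → ⟦ P ⟧ ≡ₛ ⟦ Q ⟧
  ⟦⟧-≡ₛ s-refl        = s-refl
  ⟦⟧-≡ₛ (s-sym e)     = s-sym (⟦⟧-≡ₛ e)
  ⟦⟧-≡ₛ (s-trans e f) = s-trans (⟦⟧-≡ₛ e) (⟦⟧-≡ₛ f)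
  ⟦⟧-≡ₛ (s-out e)     = ⟦out⟧-≡ₛ (⟦⟧-≡ₛ e)
  ⟦⟧-≡ₛ (s-inp e)     = ⟦inp⟧-≡ₛ (⟦⟧-≡ₛ e)
  ⟦⟧-≡ₛ (s-par e f)   = s-par (⟦⟧-≡ₛ e) (⟦⟧-≡ₛ f)
  ⟦⟧-≡ₛ (s-res e)     = s-res (⟦⟧-≡ₛ e)
  ⟦⟧-≡ₛ (s-rep e)     = s-rep (⟦⟧-≡ₛ e)
  ⟦⟧-≡ₛ par-unit      = par-unit
  ⟦⟧-≡ₛ par-comm      = par-comm
  ⟦⟧-≡ₛ par-assoc     = par-assoc
  ⟦⟧-≡ₛ rep-unf       = rep-unf
  ⟦⟧-≡ₛ res-nil       = res-nil
  ⟦⟧-≡ₛ (res-swap {P = P}) = s-trans res-swap (≡⇒≡ₛ (cong (λ W → ν (ν W)) (sym (⟦⟧-rename swapρ P))))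
  ⟦⟧-≡ₛ (res-extr {P = P} {Q = Q}) = s-trans (≡⇒≡ₛ (cong (λ W → ν (W ∣ ⟦ Q ⟧)) (⟦⟧-rename suc P))) res-extr

  ⟦⟧-success : HasSuccess P → HasSuccess ⟦ P ⟧
  ⟦⟧-success succ-√         = succ-√
  ⟦⟧-success (succ-parˡ h) = succ-parˡ (⟦⟧-success h)
  ⟦⟧-success (succ-parʳ h) = succ-parʳ (⟦⟧-success h)
  ⟦⟧-success (succ-res h)  = succ-res (⟦⟧-success h)
  ⟦⟧-success (succ-rep h)  = succ-rep (⟦⟧-success h)

  ⟦⟧-success⁻¹ : ∀ (P : Proc n) → HasSuccess ⟦ P ⟧ → HasSuccess P
  ⟦⟧-success⁻¹ (out x z P) h             = ⊥-elim (⟦out⟧-unsuccessful h)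
  ⟦⟧-success⁻¹ (inp x P)   h             = ⊥-elim (⟦inp⟧-unsuccessful h)
  ⟦⟧-success⁻¹ (P ∣ Q)     (succ-parˡ h) = succ-parˡ (⟦⟧-success⁻¹ P h)
  ⟦⟧-success⁻¹ (P ∣ Q)     (succ-parʳ h) = succ-parʳ (⟦⟧-success⁻¹ Q h)
  ⟦⟧-success⁻¹ (ν P)       (succ-res h)  = succ-res (⟦⟧-success⁻¹ P h)
  ⟦⟧-success⁻¹ (! P)       (succ-rep h)  = succ-rep (⟦⟧-success⁻¹ P h)
  ⟦⟧-success⁻¹ √           succ-√        = succ-√

  ⟦⟧-no-fout : ∀ (P : Proc n) → ¬ ⟦ P ⟧ —[ fout x z ]→ X
  ⟦⟧-no-fout (out _ _ P) d            with () ← ⟦out⟧-binds d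
  ⟦⟧-no-fout (inp _ P)   d            with () ← ⟦inp⟧-binds d
  ⟦⟧-no-fout (P ∣ Q)     (t-parˡ d)   = ⟦⟧-no-fout P d
  ⟦⟧-no-fout (P ∣ Q)     (t-parʳ d)   = ⟦⟧-no-fout Q d
  ⟦⟧-no-fout (ν P)       (t-resout d) = ⟦⟧-no-fout P d
  ⟦⟧-no-fout (! P)       (t-rep d)    = ⟦⟧-no-fout (P ∣ ! P) d

module AdministrativeStates (E : PrefixEncoding) (Bl : Blocks) where
  open PrefixEncoding E
  open Compositional E
  open Blocks Bl

  data State (n : ℕ) : Set where
    src     : Proc n → State n
    par     : State n → State n → State n
    res     : State (suc n) → State n
    deliver : Fin n → Proc (suc n) → State n   -- ν u (ū z ∣ u(y).⟦Q⟧), standing for Q{z/y}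
    block   : Block n → State n

  enc : State n → Proc n
  enc (src P)       = ⟦ P ⟧
  enc (par E F)     = enc E ∣ enc F
  enc (res E)       = ν (enc E)
  enc (deliver z Q) = ν (aout zero (suc z) ∣ inp zero (rename (lift suc) ⟦ Q ⟧))
  enc (block B)     = encB B

  dec : State n → Proc n
  dec (src P)       = P
  dec (par E F)     = dec E ∣ dec F
  dec (res E)       = ν (dec E)
  dec (deliver z Q) = Q [ z ]
  dec (block B)     = decB B

  renameState : (Fin n → Fin m) → State n → State m
  renameState ρ (src P)       = src (rename ρ P)
  renameState ρ (par E F)     = par (renameState ρ E) (renameState ρ F)
  renameState ρ (res E)       = res (renameState (lift ρ) E)
  renameState ρ (deliver z Q) = deliver (ρ z) (rename (lift ρ) Q)
  renameState ρ (block B)     = block (renameB ρ B)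

  enc-rename : ∀ (ρ : Fin n → Fin m) E → enc (renameState ρ E) ≡ rename ρ (enc E)
  enc-rename ρ (src P)       = ⟦⟧-rename ρ P
  enc-rename ρ (par E F)     = cong₂ _∣_ (enc-rename ρ E) (enc-rename ρ F)
  enc-rename ρ (res E)       = cong ν (enc-rename (lift ρ) E)
  enc-rename ρ (deliver z Q) = cong (λ W → ν (aout zero (suc (ρ z)) ∣ inp zero W))
    (trans (cong (rename (lift suc)) (⟦⟧-rename (lift ρ) Q)) (sym (rename-lift-lift-suc ρ ⟦ Q ⟧)))
  enc-rename ρ (block B)     = encB-rename ρ B

  dec-rename : ∀ (ρ : Fin n → Fin m) E → dec (renameState ρ E) ≡ rename ρ (dec E)
  dec-rename ρ (src P)       = refl
  dec-rename ρ (par E F)     = cong₂ _∣_ (dec-rename ρ E) (dec-rename ρ F)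
  dec-rename ρ (res E)       = cong ν (dec-rename (lift ρ) E)
  dec-rename ρ (deliver z Q) = sym (rename-[] ρ z Q)
  dec-rename ρ (block B)     = decB-rename ρ B

  enc-success⁻¹ : ∀ (E : State n) → HasSuccess (enc E) → HasSuccess (dec E)
  enc-success⁻¹ (src P)   h             = ⟦⟧-success⁻¹ P h
  enc-success⁻¹ (par E F) (succ-parˡ h) = succ-parˡ (enc-success⁻¹ E h)
  enc-success⁻¹ (par E F) (succ-parʳ h) = succ-parʳ (enc-success⁻¹ F h)
  enc-success⁻¹ (res E)   (succ-res h)  = succ-res (enc-success⁻¹ E h)
  enc-success⁻¹ (deliver z Q) (succ-res (succ-parˡ ()))
  enc-success⁻¹ (deliver z Q) (succ-res (succ-parʳ ()))
  enc-success⁻¹ (block B) h             = ⊥-elim (encB-unsuccessful B h)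

  deliver-silent : ∀ (z : Fin n) Q {a : Action n b} → enc (deliver z Q) —[ a ]→ X → Silent a
  deliver-silent z Q (t-resτ d) = silent
  deliver-silent z Q (t-resout (t-parˡ ()))
  deliver-silent z Q (t-resout (t-parʳ ()))
  deliver-silent z Q (t-resinp (t-parˡ ()))
  deliver-silent z Q (t-resinp (t-parʳ ()))
  deliver-silent z Q (t-resbout (t-parˡ ()))
  deliver-silent z Q (t-resbout (t-parʳ ()))
  deliver-silent z Q (t-open (t-parˡ ()))
  deliver-silent z Q (t-open (t-parʳ ()))

  enc-no-fout : ∀ (E : State n) → ¬ enc E —[ fout x z ]→ X
  enc-no-fout (src P)       d            = ⟦⟧-no-fout P d
  enc-no-fout (par E F)     (t-parˡ d)   = enc-no-fout E d
  enc-no-fout (par E F)     (t-parʳ d)   = enc-no-fout F d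
  enc-no-fout (res E)       (t-resout d) = enc-no-fout E d
  enc-no-fout (deliver z Q) d            with () ← deliver-silent z Q d
  enc-no-fout (block B)     d            with () ← encB-silent B d

  deliver-reduct : ∀ (z : Fin n) Q → ν (𝟘 ∣ rename (lift suc) ⟦ Q ⟧ [ suc z ]) ≡ₛ ⟦ Q [ z ] ⟧
  deliver-reduct z Q =
    s-trans (s-res (s-trans par-unitˡ (≡⇒≡ₛ (trans (lift-suc-[suc] z ⟦ Q ⟧)
                                                   (cong wk (sym (⟦⟧-rename (substρ z) Q)))))))
            res-wk

  deliver-⟶*ₛ : ∀ (z : Fin n) Q → enc (deliver z Q) ⟶*ₛ ⟦ Q [ z ] ⟧
  deliver-⟶*ₛ z Q = _ , r-res r-comm ◅ ε , deliver-reduct z Q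

  -- A source prefix with subject x and what its translation becomes after its first
  -- action, whose bound name is index 0 of the residual.
  record Hole : Set₁ where
    field
      Data            : ℕ → Set
      prefix          : Fin n → Data n → Proc n
      residual        : Data n → Proc (suc n)
      renameData      : (Fin n → Fin m) → Data n → Data m
      prefix-rename   : ∀ (ρ : Fin n → Fin m) x h → prefix (ρ x) (renameData ρ h) ≡ rename ρ (prefix x h)
      residual-rename : ∀ (ρ : Fin n → Fin m) h → residual (renameData ρ h) ≡ rename (lift ρ) (residual h)

  open Hole

  outHole : (after : ∀ {n} → Fin n → Proc n → Proc (suc n)) →
            (∀ {n m} (ρ : Fin n → Fin m) z R → after (ρ z) (rename ρ R) ≡ rename (lift ρ) (after z R)) →
            Hole
  outHole after after-rename = record
    { Data            = λ n → Fin n × Proc n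
    ; prefix          = λ { x (z , P) → out x z P }
    ; residual        = λ { (z , P) → after z ⟦ P ⟧ }
    ; renameData      = λ { ρ (z , P) → ρ z , rename ρ P }
    ; prefix-rename   = λ _ _ _ → refl
    ; residual-rename = λ { ρ (z , P) → trans (cong (after (ρ z)) (⟦⟧-rename ρ P)) (after-rename ρ z ⟦ P ⟧) }
    }

  inpHole : (after : ∀ {n} → Proc (suc n) → Proc (suc n)) →
            (∀ {n m} (ρ : Fin n → Fin m) S → after (rename (lift ρ) S) ≡ rename (lift ρ) (after S)) →
            Hole
  inpHole after after-rename = record
    { Data            = λ n → Proc (suc n)
    ; prefix          = inp
    ; residual        = λ Q → after ⟦ Q ⟧
    ; renameData      = λ ρ → rename (lift ρ)
    ; prefix-rename   = λ _ _ _ → refl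
    ; residual-rename = λ ρ Q → trans (cong after (⟦⟧-rename (lift ρ) Q)) (after-rename ρ ⟦ Q ⟧)
    }

  -- A state in which a translated prefix of kind H on channel x is unguarded.
  data Exposed (H : Hole) : (n : ℕ) → Fin n → Set where
    hole : Data H n → Exposed H n x
    _◁_  : Exposed H n x → State n → Exposed H n x
    _▷_  : State n → Exposed H n x → Exposed H n x
    ν    : Exposed H (suc n) (suc x) → Exposed H n x

  module _ {H : Hole} where

    residualOf : Exposed H n x → Proc (suc n)
    residualOf (hole h) = residual H h
    residualOf (C ◁ F)  = residualOf C ∣ wk (enc F)
    residualOf (F ▷ C)  = wk (enc F) ∣ residualOf C
    residualOf (ν C)    = ν (rename swapρ (residualOf C))

    sourceOf : Exposed H n x → Proc n
    sourceOf {x = x} (hole h) = prefix H x h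
    sourceOf (C ◁ F)          = sourceOf C ∣ dec F
    sourceOf (F ▷ C)          = dec F ∣ sourceOf C
    sourceOf (ν C)            = ν (sourceOf C)

    renameExposed : (ρ : Fin n → Fin m) → Exposed H n x → Exposed H m (ρ x)
    renameExposed ρ (hole h) = hole (renameData H ρ h)
    renameExposed ρ (C ◁ F)  = renameExposed ρ C ◁ renameState ρ F
    renameExposed ρ (F ▷ C)  = renameState ρ F ▷ renameExposed ρ C
    renameExposed ρ (ν C)    = ν (renameExposed (lift ρ) C)

    private
      wk-enc-rename : ∀ (ρ : Fin n → Fin m) F → wk (enc (renameState ρ F)) ≡ rename (lift ρ) (wk (enc F))
      wk-enc-rename ρ F = trans (cong wk (enc-rename ρ F)) (sym (rename-lift-wk ρ (enc F)))

    residualOf-rename : ∀ (ρ : Fin n → Fin m) (C : Exposed H n x) →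
                        residualOf (renameExposed ρ C) ≡ rename (lift ρ) (residualOf C)
    residualOf-rename ρ (hole h) = residual-rename H ρ h
    residualOf-rename ρ (C ◁ F)  = cong₂ _∣_ (residualOf-rename ρ C) (wk-enc-rename ρ F)
    residualOf-rename ρ (F ▷ C)  = cong₂ _∣_ (wk-enc-rename ρ F) (residualOf-rename ρ C)
    residualOf-rename ρ (ν C)    =
      cong ν (trans (cong (rename swapρ) (residualOf-rename (lift ρ) C))
                    (sym (rename-swapρ-lift-lift ρ (residualOf C))))

    sourceOf-rename : ∀ (ρ : Fin n → Fin m) (C : Exposed H n x) →
                      sourceOf (renameExposed ρ C) ≡ rename ρ (sourceOf C)
    sourceOf-rename {x = x} ρ (hole h) = prefix-rename H ρ x h
    sourceOf-rename ρ (C ◁ F)  = cong₂ _∣_ (sourceOf-rename ρ C) (dec-rename ρ F)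
    sourceOf-rename ρ (F ▷ C)  = cong₂ _∣_ (dec-rename ρ F) (sourceOf-rename ρ C)
    sourceOf-rename ρ (ν C)    = cong ν (sourceOf-rename (lift ρ) C)

  Reveals : Hole → Proc n → Fin n → Proc (suc n) → Set
  Reveals {n} H S x X = ∃ λ (C : Exposed H n x) → X ≡ₛ residualOf C × S ≡ₛ sourceOf C

  module _ {H : Hole} where

    reveals◁ : Reveals H S x X → ∀ F → Reveals H (S ∣ dec F) x (X ∣ wk (enc F))
    reveals◁ (C , eX , eS) F = C ◁ F , parˡ-≡ₛ eX , parˡ-≡ₛ eS

    reveals▷ : ∀ F → Reveals H S x X → Reveals H (dec F ∣ S) x (wk (enc F) ∣ X)
    reveals▷ F (C , eX , eS) = F ▷ C , parʳ-≡ₛ eX , parʳ-≡ₛ eS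

    revealsν : Reveals H S (suc x) X → Reveals H (ν S) x (ν (rename swapρ X))
    revealsν (C , eX , eS) = ν C , s-res (rename-≡ₛ swapρ eX) , s-res eS

    reveals-≡ₛ : S ≡ₛ S′ → Reveals H S′ x X → Reveals H S x X
    reveals-≡ₛ e (C , eX , eS) = C , eX , s-trans e eS

  Step : Proc n → Proc n → Set
  Step S X = ∃ λ E′ → X ≡ₛ enc E′ × (S ⟶ dec E′ ⊎ S ≡ₛ dec E′)

  step◁ : Step S X → ∀ F → Step (S ∣ dec F) (X ∣ enc F)
  step◁ (E′ , eX , inj₁ r) F = par E′ F , parˡ-≡ₛ eX , inj₁ (r-par r)
  step◁ (E′ , eX , inj₂ e) F = par E′ F , parˡ-≡ₛ eX , inj₂ (parˡ-≡ₛ e)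

  step▷ : ∀ F → Step S X → Step (dec F ∣ S) (enc F ∣ X)
  step▷ F (E′ , eX , inj₁ r) = par F E′ , parʳ-≡ₛ eX , inj₁ (⟶-parʳ r)
  step▷ F (E′ , eX , inj₂ e) = par F E′ , parʳ-≡ₛ eX , inj₂ (parʳ-≡ₛ e)

  stepν : {S X : Proc (suc n)} → Step S X → Step (ν S) (ν X)
  stepν (E′ , eX , inj₁ r) = res E′ , s-res eX , inj₁ (r-res r)
  stepν (E′ , eX , inj₂ e) = res E′ , s-res eX , inj₂ (s-res e)

  step-≡ₛ : S ≡ₛ S′ → Step S′ X → Step S X
  step-≡ₛ e (E′ , eX , inj₁ r)  = E′ , eX , inj₁ (r-struct e r s-refl)
  step-≡ₛ e (E′ , eX , inj₂ e′) = E′ , eX , inj₂ (s-trans e e′)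

  record Administration : Set₁ where
    field
      -- prefixes whose translation starts with a bound output, resp. an input
      Hᵇ Hⁱ           : Hole
      ⟦out⟧-reveals-bout  : ∀ x z (P : Proc n) → ⟦ out x z P ⟧ —[ bout y ]→ X → Reveals Hᵇ (out x z P) y X
      ⟦inp⟧-reveals-bout  : ∀ x (Q : Proc (suc n)) → ⟦ inp x Q ⟧ —[ bout y ]→ X → Reveals Hᵇ (inp x Q) y X
      ⟦out⟧-reveals-input : ∀ x z (P : Proc n) → ⟦ out x z P ⟧ —[ input y ]→ X → Reveals Hⁱ (out x z P) y X
      ⟦inp⟧-reveals-input : ∀ x (Q : Proc (suc n)) → ⟦ inp x Q ⟧ —[ input y ]→ X → Reveals Hⁱ (inp x Q) y X
      meet          : Data Hᵇ n → Data Hⁱ n → State n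
      meet-residual : ∀ (h : Data Hᵇ n) h′ → ν (residual Hᵇ h ∣ residual Hⁱ h′) ≡ₛ enc (meet h h′)
      meet-prefix   : ∀ (x : Fin n) h h′ → prefix Hᵇ x h ∣ prefix Hⁱ x h′ ⟶ dec (meet h h′)
      block-τ       : ∀ (B : Block n) {X} → encB B —[ τ ]→ X → Step (decB B) X
      block-settle  : ∀ (B : Block n) → encB B ⟶*ₛ ⟦ decB B ⟧
      comm-start    : ∀ x z (P : Proc n) Q →
                      ∃ λ E → ⟦ out x z P ∣ inp x Q ⟧ ⟶ enc E × dec E ≡ (P ∣ Q [ z ])

  module Correct (A : Administration) where
    open Administration A

    meetᴱ : Data Hᵇ n → Exposed Hⁱ n x → State n
    meetᴱ h (hole h′) = meet h h′
    meetᴱ h (M ◁ F)   = par (meetᴱ h M) F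
    meetᴱ h (F ▷ M)   = par F (meetᴱ h M)
    meetᴱ h (ν M)     = res (meetᴱ (renameData Hᵇ suc h) M)

    combine : Exposed Hᵇ n x → Exposed Hⁱ n x → State n
    combine (hole h) M = meetᴱ h M
    combine (N ◁ F)  M = par (combine N M) F
    combine (F ▷ N)  M = par F (combine N M)
    combine (ν N)    M = res (combine N (renameExposed suc M))

    meetᴱ-prefix : ∀ (h : Data Hᵇ n) (M : Exposed Hⁱ n x) → prefix Hᵇ x h ∣ sourceOf M ⟶ dec (meetᴱ h M)
    meetᴱ-prefix {x = x} h (hole h′) = meet-prefix x h h′
    meetᴱ-prefix h (M ◁ F) = r-struct (s-sym par-assoc) (r-par (meetᴱ-prefix h M)) s-refl
    meetᴱ-prefix h (F ▷ M) = r-struct par-leftComm (⟶-parʳ (meetᴱ-prefix h M)) s-refl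
    meetᴱ-prefix {x = x} h (ν M) =
      r-struct (s-trans (s-sym res-extr) (s-res (parˡ-≡ₛ (≡⇒≡ₛ (sym (prefix-rename Hᵇ suc x h))))))
               (r-res (meetᴱ-prefix (renameData Hᵇ suc h) M)) s-refl

    combine-source : ∀ (N : Exposed Hᵇ n x) M → sourceOf N ∣ sourceOf M ⟶ dec (combine N M)
    combine-source (hole h) M = meetᴱ-prefix h M
    combine-source (N ◁ F)  M = r-struct par-rightComm (r-par (combine-source N M)) s-refl
    combine-source (F ▷ N)  M = r-struct par-assoc (⟶-parʳ (combine-source N M)) s-refl
    combine-source (ν N)    M =
      r-struct (s-trans (s-sym res-extrʳ) (s-res (parʳ-≡ₛ (≡⇒≡ₛ (sym (sourceOf-rename suc M))))))
               (r-res (combine-source N (renameExposed suc M))) s-refl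

    meetᴱ-residual : ∀ (h : Data Hᵇ n) (M : Exposed Hⁱ n x) →
                     ν (residual Hᵇ h ∣ residualOf M) ≡ₛ enc (meetᴱ h M)
    meetᴱ-residual h (hole h′) = meet-residual h h′
    meetᴱ-residual h (M ◁ F)   = s-trans (s-res (s-sym par-assoc)) (s-trans res-extrʳ (parˡ-≡ₛ (meetᴱ-residual h M)))
    meetᴱ-residual h (F ▷ M)   = s-trans (s-res par-leftComm) (s-trans res-extr (parʳ-≡ₛ (meetᴱ-residual h M)))
    meetᴱ-residual {n = n} h (ν M) = begin
      ν (r ∣ ν (rename swapρ M′))                                ≈⟨ s-res (s-sym res-extr) ⟩
      ν (ν (wk r ∣ rename swapρ M′))                             ≈⟨ res-swap ⟩
      ν (ν (rename swapρ (wk r) ∣ rename swapρ (rename swapρ M′))) ≡⟨ cong₂ (λ A B → ν (ν (A ∣ B)))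
                                                                         r-swapped (rename-swapρ-involutive M′) ⟩
      ν (ν (residual Hᵇ (renameData Hᵇ suc h) ∣ M′))              ≈⟨ s-res (meetᴱ-residual _ M) ⟩
      enc (meetᴱ h (ν M))                                        ∎
      where
      open ≡ₛ-Reasoning
      r : Proc (suc n)
      r = residual Hᵇ h
      M′ : Proc (suc (suc n))
      M′ = residualOf M
      r-swapped : rename swapρ (wk r) ≡ residual Hᵇ (renameData Hᵇ suc h)
      r-swapped = trans (rename-fuse swapρ-suc r) (sym (residual-rename Hᵇ suc h))

    combine-residual : ∀ (N : Exposed Hᵇ n x) M → ν (residualOf N ∣ residualOf M) ≡ₛ enc (combine N M)
    combine-residual (hole h) M = meetᴱ-residual h M
    combine-residual (N ◁ F)  M = s-trans (s-res par-rightComm) (s-trans res-extrʳ (parˡ-≡ₛ (combine-residual N M)))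
    combine-residual (F ▷ N)  M = s-trans (s-res par-assoc) (s-trans res-extr (parʳ-≡ₛ (combine-residual N M)))
    combine-residual {n = n} (ν N) M = begin
      ν (ν (rename swapρ N′) ∣ M′)                                 ≈⟨ s-res (s-sym res-extrʳ) ⟩
      ν (ν (rename swapρ N′ ∣ wk M′))                              ≈⟨ res-swap ⟩
      ν (ν (rename swapρ (rename swapρ N′) ∣ rename swapρ (wk M′))) ≡⟨ cong₂ (λ A B → ν (ν (A ∣ B)))
                                                                         (rename-swapρ-involutive N′) M-swapped ⟩
      ν (ν (N′ ∣ residualOf (renameExposed suc M)))                ≈⟨ s-res (combine-residual N _) ⟩
      enc (combine (ν N) M)                                        ∎
      where
      open ≡ₛ-Reasoning
      N′ : Proc (suc (suc n))
      N′ = residualOf N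
      M′ : Proc (suc n)
      M′ = residualOf M
      M-swapped : rename swapρ (wk M′) ≡ residualOf (renameExposed suc M)
      M-swapped = trans (rename-fuse swapρ-suc M′) (sym (residualOf-rename suc M))

    step-close : Reveals Hᵇ S x X → Reveals Hⁱ S′ x Y → Step (S ∣ S′) (ν (X ∣ Y))
    step-close (N , eX , eS) (M , eY , eS′) =
      combine N M , s-trans (s-res (s-par eX eY)) (combine-residual N M) ,
      inj₁ (r-struct (s-par eS eS′) (combine-source N M) s-refl)

    step-close′ : Reveals Hⁱ S x X → Reveals Hᵇ S′ x Y → Step (S ∣ S′) (ν (X ∣ Y))
    step-close′ (M , eX , eS) (N , eY , eS′) =
      combine N M , s-trans (s-res (s-trans (s-par eX eY) par-comm)) (combine-residual N M) ,
      inj₁ (r-struct (s-trans (s-par eS eS′) par-comm) (combine-source N M) s-refl)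

    ⟦⟧-reveals-bout : ∀ (P : Proc n) → ⟦ P ⟧ —[ bout x ]→ X → Reveals Hᵇ P x X
    ⟦⟧-reveals-bout (out x z P) d           = ⟦out⟧-reveals-bout x z P d
    ⟦⟧-reveals-bout (inp x Q)   d           = ⟦inp⟧-reveals-bout x Q d
    ⟦⟧-reveals-bout (P ∣ Q) (t-parˡ d)      = reveals◁ (⟦⟧-reveals-bout P d) (src Q)
    ⟦⟧-reveals-bout (P ∣ Q) (t-parʳ d)      = reveals▷ (src P) (⟦⟧-reveals-bout Q d)
    ⟦⟧-reveals-bout (ν P)   (t-resbout d)   = revealsν (⟦⟧-reveals-bout P d)
    ⟦⟧-reveals-bout (ν P)   (t-open d)      = ⊥-elim (⟦⟧-no-fout P d)
    ⟦⟧-reveals-bout (! P)   (t-rep d)       = reveals-≡ₛ rep-unf (⟦⟧-reveals-bout (P ∣ ! P) d)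

    ⟦⟧-reveals-input : ∀ (P : Proc n) → ⟦ P ⟧ —[ input x ]→ X → Reveals Hⁱ P x X
    ⟦⟧-reveals-input (out x z P) d          = ⟦out⟧-reveals-input x z P d
    ⟦⟧-reveals-input (inp x Q)   d          = ⟦inp⟧-reveals-input x Q d
    ⟦⟧-reveals-input (P ∣ Q) (t-parˡ d)     = reveals◁ (⟦⟧-reveals-input P d) (src Q)
    ⟦⟧-reveals-input (P ∣ Q) (t-parʳ d)     = reveals▷ (src P) (⟦⟧-reveals-input Q d)
    ⟦⟧-reveals-input (ν P)   (t-resinp d)   = revealsν (⟦⟧-reveals-input P d)
    ⟦⟧-reveals-input (! P)   (t-rep d)      = reveals-≡ₛ rep-unf (⟦⟧-reveals-input (P ∣ ! P) d)

    enc-reveals-bout : ∀ (E : State n) → enc E —[ bout x ]→ X → Reveals Hᵇ (dec E) x X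
    enc-reveals-bout (src P)       d             = ⟦⟧-reveals-bout P d
    enc-reveals-bout (par E F)     (t-parˡ d)    = reveals◁ (enc-reveals-bout E d) F
    enc-reveals-bout (par E F)     (t-parʳ d)    = reveals▷ E (enc-reveals-bout F d)
    enc-reveals-bout (res E)       (t-resbout d) = revealsν (enc-reveals-bout E d)
    enc-reveals-bout (res E)       (t-open d)    = ⊥-elim (enc-no-fout E d)
    enc-reveals-bout (deliver z Q) d             with () ← deliver-silent z Q d
    enc-reveals-bout (block B)     d             with () ← encB-silent B d

    enc-reveals-input : ∀ (E : State n) → enc E —[ input x ]→ X → Reveals Hⁱ (dec E) x X
    enc-reveals-input (src P)       d            = ⟦⟧-reveals-input P d
    enc-reveals-input (par E F)     (t-parˡ d)   = reveals◁ (enc-reveals-input E d) F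
    enc-reveals-input (par E F)     (t-parʳ d)   = reveals▷ E (enc-reveals-input F d)
    enc-reveals-input (res E)       (t-resinp d) = revealsν (enc-reveals-input E d)
    enc-reveals-input (deliver z Q) d            with () ← deliver-silent z Q d
    enc-reveals-input (block B)     d            with () ← encB-silent B d

    ⟦⟧-τ : ∀ (P : Proc n) → ⟦ P ⟧ —[ τ ]→ X → Step P X
    ⟦⟧-τ (out x z P) d              with () ← ⟦out⟧-binds d
    ⟦⟧-τ (inp x Q)   d              with () ← ⟦inp⟧-binds d
    ⟦⟧-τ (P ∣ Q)     (t-parˡ d)     = step◁ (⟦⟧-τ P d) (src Q)
    ⟦⟧-τ (P ∣ Q)     (t-parʳ d)     = step▷ (src P) (⟦⟧-τ Q d)
    ⟦⟧-τ (P ∣ Q)     (t-commˡ d e)  = ⊥-elim (⟦⟧-no-fout P d)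
    ⟦⟧-τ (P ∣ Q)     (t-commʳ d e)  = ⊥-elim (⟦⟧-no-fout Q e)
    ⟦⟧-τ (P ∣ Q)     (t-closeˡ d e) = step-close (⟦⟧-reveals-bout P d) (⟦⟧-reveals-input Q e)
    ⟦⟧-τ (P ∣ Q)     (t-closeʳ d e) = step-close′ (⟦⟧-reveals-input P d) (⟦⟧-reveals-bout Q e)
    ⟦⟧-τ (ν P)       (t-resτ d)     = stepν (⟦⟧-τ P d)
    ⟦⟧-τ (! P)       (t-rep d)      = step-≡ₛ rep-unf (⟦⟧-τ (P ∣ ! P) d)

    enc-τ : ∀ (E : State n) → enc E —[ τ ]→ X → Step (dec E) X
    enc-τ (src P)       d              = ⟦⟧-τ P d
    enc-τ (par E F)     (t-parˡ d)     = step◁ (enc-τ E d) F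
    enc-τ (par E F)     (t-parʳ d)     = step▷ E (enc-τ F d)
    enc-τ (par E F)     (t-commˡ d e)  = ⊥-elim (enc-no-fout E d)
    enc-τ (par E F)     (t-commʳ d e)  = ⊥-elim (enc-no-fout F e)
    enc-τ (par E F)     (t-closeˡ d e) = step-close (enc-reveals-bout E d) (enc-reveals-input F e)
    enc-τ (par E F)     (t-closeʳ d e) = step-close′ (enc-reveals-input E d) (enc-reveals-bout F e)
    enc-τ (res E)       (t-resτ d)     = stepν (enc-τ E d)
    enc-τ (deliver z Q) (t-resτ (t-commˡ t-out t-inp)) = src (Q [ z ]) , deliver-reduct z Q , inj₂ s-refl
    enc-τ (block B)     d              = block-τ B d

    reflect : ∀ (E : State n) → enc E ⟶ X → Step (dec E) X
    reflect E r with ⟶⇒τ r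
    ... | _ , d , e with enc-τ E d
    ... | E′ , e′ , s = E′ , s-trans (s-sym e) e′ , s

    settle : ∀ (E : State n) → enc E ⟶*ₛ ⟦ dec E ⟧
    settle (src P)       = ≡ₛ⇒⟶*ₛ s-refl
    settle (par E F)     = ⟶*ₛ-par (settle E) (settle F)
    settle (res E)       = ⟶*ₛ-res (settle E)
    settle (deliver z Q) = deliver-⟶*ₛ z Q
    settle (block B)     = block-settle B

    simulate : P ⟶ P′ → ⟦ P ⟧ ⟶*ₛ ⟦ P′ ⟧
    simulate (r-comm {x} {z} {P} {Q}) with comm-start x z P Q
    ... | E , r , eq = ⟶*ₛ-trans (⟶*⇒⟶*ₛ (r ◅ ε)) (subst (λ S → enc E ⟶*ₛ ⟦ S ⟧) eq (settle E))
    simulate (r-par r)          = ⟶*ₛ-par (simulate r) (≡ₛ⇒⟶*ₛ s-refl)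
    simulate (r-res r)          = ⟶*ₛ-res (simulate r)
    simulate (r-struct e r e′)  = ≡ₛ-⟶*ₛ (⟦⟧-≡ₛ e) (⟶*ₛ-trans (simulate r) (≡ₛ⇒⟶*ₛ (⟦⟧-≡ₛ e′)))

    correspondence : Correspondence ⟦_⟧
    correspondence = record
      { State         = State
      ; enc           = enc
      ; dec           = dec
      ; init          = src
      ; enc-init      = λ _ → s-refl
      ; dec-init      = λ _ → s-refl
      ; reflect       = λ E → reflect E
      ; settle        = settle
      ; simulate      = simulate
      ; success       = ⟦⟧-success
      ; enc-success⁻¹ = enc-success⁻¹
      }

module Boudol where

  private
    wk₂ : Fin n → Fin (suc (suc n))
    wk₂ i = suc (suc i)

    wk₃ : Fin n → Fin (suc (suc (suc n)))
    wk₃ i = suc (suc (suc i))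

    wk₂-rename : ∀ (ρ : Fin n → Fin m) R → rename wk₂ (rename ρ R) ≡ rename (lift (lift ρ)) (rename wk₂ R)
    wk₂-rename ρ = rename-square λ _ → refl

    wk2lift-rename : ∀ (ρ : Fin n → Fin m) S →
                     rename wk2lift (rename (lift ρ) S) ≡ rename (lift (lift (lift ρ))) (rename wk2lift S)
    wk2lift-rename ρ = rename-square λ { zero → refl ; (suc _) → refl }

  ⟦out⟧ : Fin n → Fin n → Proc n → Proc n
  ⟦out⟧ x z R = ν (aout (suc x) zero ∣ inp zero (aout zero (suc (suc z)) ∣ rename wk₂ R))

  input-residual : Proc (suc n) → Proc (suc n)
  input-residual S = ν (aout (suc zero) zero ∣ inp zero (rename wk2lift S))

  ⟦inp⟧ : Fin n → Proc (suc n) → Proc n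
  ⟦inp⟧ x S = inp x (input-residual S)

  bout-residual : Fin n → Proc n → Proc (suc n)
  bout-residual z R = 𝟘 ∣ inp zero (aout zero (suc (suc z)) ∣ rename wk₂ R)

  bout-residual-rename : ∀ (ρ : Fin n → Fin m) z R →
                         bout-residual (ρ z) (rename ρ R) ≡ rename (lift ρ) (bout-residual z R)
  bout-residual-rename ρ z R = cong (λ W → 𝟘 ∣ inp zero (aout zero (suc (suc (ρ z))) ∣ W)) (wk₂-rename ρ R)

  input-residual-rename : ∀ (ρ : Fin n → Fin m) S →
                          input-residual (rename (lift ρ) S) ≡ rename (lift ρ) (input-residual S)
  input-residual-rename ρ S = cong (λ W → ν (aout (suc zero) zero ∣ inp zero W)) (wk2lift-rename ρ S)

  prefixes : PrefixEncoding
  prefixes = record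
    { ⟦out⟧              = ⟦out⟧
    ; ⟦inp⟧              = ⟦inp⟧
    ; ⟦out⟧-rename       = λ ρ x z R →
                             cong (λ W → ν (aout (suc (ρ x)) zero ∣ inp zero (aout zero (suc (suc (ρ z))) ∣ W)))
                                  (wk₂-rename ρ R)
    ; ⟦inp⟧-rename       = λ ρ x S → cong (inp (ρ x)) (input-residual-rename ρ S)
    ; ⟦out⟧-≡ₛ           = λ e → s-res (parʳ-≡ₛ (s-inp (parʳ-≡ₛ (rename-≡ₛ wk₂ e))))
    ; ⟦inp⟧-≡ₛ           = λ e → s-inp (s-res (parʳ-≡ₛ (s-inp (rename-≡ₛ wk2lift e))))
    ; ⟦out⟧-unsuccessful = fresh-output-unsuccessful
    ; ⟦inp⟧-unsuccessful = λ ()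
    ; ⟦out⟧-binds        = fresh-output-binds
    ; ⟦inp⟧-binds        = λ { t-inp → refl }
    }

  open Compositional prefixes

  -- ν u ν v (ū v ∣ u(w).(w̄ z ∣ ⟦P⟧) ∣ v(y).⟦Q⟧), reached once x(u).… has received u.
  data Handshake (n : ℕ) : Set where
    handshake : Fin n → Proc n → Proc (suc n) → Handshake n

  encHandshake : Handshake n → Proc n
  encHandshake (handshake z P Q) =
    ν (ν ((aout (suc zero) zero ∣ inp (suc zero) (aout zero (suc (suc (suc z))) ∣ rename wk₃ ⟦ P ⟧))
          ∣ inp zero (rename wk2lift ⟦ Q ⟧)))

  decHandshake : Handshake n → Proc n
  decHandshake (handshake z P Q) = P ∣ Q [ z ]

  renameHandshake : (Fin n → Fin m) → Handshake n → Handshake m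
  renameHandshake ρ (handshake z P Q) = handshake (ρ z) (rename ρ P) (rename (lift ρ) Q)

  encHandshake-rename : ∀ (ρ : Fin n → Fin m) B →
                        encHandshake (renameHandshake ρ B) ≡ rename ρ (encHandshake B)
  encHandshake-rename ρ (handshake z P Q) =
    cong₂ (λ W V → ν (ν ((aout (suc zero) zero ∣ inp (suc zero) (aout zero (suc (suc (suc (ρ z)))) ∣ W))
                         ∣ inp zero V)))
          (trans (cong (rename wk₃) (⟦⟧-rename ρ P)) (rename-square (λ _ → refl) ⟦ P ⟧))
          (trans (cong (rename wk2lift) (⟦⟧-rename (lift ρ) Q)) (wk2lift-rename ρ ⟦ Q ⟧))

  encHandshake-silent : ∀ (B : Handshake n) {a : Action n b} → encHandshake B —[ a ]→ X → Silent a
  encHandshake-silent (handshake z P Q) (t-resτ _) = silent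
  encHandshake-silent (handshake z P Q) (t-resout (t-resout (t-parˡ (t-parˡ ()))))
  encHandshake-silent (handshake z P Q) (t-resout (t-resout (t-parˡ (t-parʳ ()))))
  encHandshake-silent (handshake z P Q) (t-resout (t-resout (t-parʳ ())))
  encHandshake-silent (handshake z P Q) (t-resinp (t-resinp (t-parˡ (t-parˡ ()))))
  encHandshake-silent (handshake z P Q) (t-resinp (t-resinp (t-parˡ (t-parʳ ()))))
  encHandshake-silent (handshake z P Q) (t-resinp (t-resinp (t-parʳ ())))
  encHandshake-silent (handshake z P Q) (t-resbout (t-resbout (t-parˡ (t-parˡ ()))))
  encHandshake-silent (handshake z P Q) (t-resbout (t-resbout (t-parˡ (t-parʳ ()))))
  encHandshake-silent (handshake z P Q) (t-resbout (t-resbout (t-parʳ ())))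
  encHandshake-silent (handshake z P Q) (t-resbout (t-open (t-parˡ (t-parˡ ()))))
  encHandshake-silent (handshake z P Q) (t-resbout (t-open (t-parˡ (t-parʳ ()))))
  encHandshake-silent (handshake z P Q) (t-resbout (t-open (t-parʳ ())))
  encHandshake-silent (handshake z P Q) (t-open (t-resout (t-parˡ (t-parˡ ()))))
  encHandshake-silent (handshake z P Q) (t-open (t-resout (t-parˡ (t-parʳ ()))))
  encHandshake-silent (handshake z P Q) (t-open (t-resout (t-parʳ ())))

  blocks : Blocks
  blocks = record
    { Block             = Handshake
    ; encB              = encHandshake
    ; decB              = decHandshake
    ; renameB           = renameHandshake
    ; encB-rename       = encHandshake-rename
    ; decB-rename       = λ { ρ (handshake z P Q) → cong (rename ρ P ∣_) (sym (rename-[] ρ z Q)) }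
    ; encB-unsuccessful = λ { (handshake z P Q) (succ-res (succ-res (succ-parˡ (succ-parˡ ()))))
                            ; (handshake z P Q) (succ-res (succ-res (succ-parˡ (succ-parʳ ()))))
                            ; (handshake z P Q) (succ-res (succ-res (succ-parʳ ()))) }
    ; encB-silent       = encHandshake-silent
    }

  open AdministrativeStates prefixes blocks

  Hᵇ Hⁱ : Hole
  Hᵇ = outHole bout-residual bout-residual-rename
  Hⁱ = inpHole input-residual input-residual-rename

  handshake-residual : ∀ (z : Fin n) P Q →
    ν (bout-residual z ⟦ P ⟧ ∣ input-residual ⟦ Q ⟧) ≡ₛ enc (block (handshake z P Q))
  handshake-residual {n} z P Q = begin
    ν ((𝟘 ∣ I) ∣ ν (O ∣ J))        ≈⟨ s-res (parˡ-≡ₛ par-unitˡ) ⟩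
    ν (I ∣ ν (O ∣ J))              ≈⟨ s-res (s-sym res-extr) ⟩
    ν (ν (wk I ∣ (O ∣ J)))         ≈⟨ s-res (s-res (s-trans (s-sym par-assoc) (parˡ-≡ₛ par-comm))) ⟩
    ν (ν ((O ∣ wk I) ∣ J))         ≡⟨ cong (λ W → ν (ν ((O ∣ inp (suc zero) (aout zero w ∣ W)) ∣ J)))
                                           (rename-fuse (λ _ → refl) ⟦ P ⟧) ⟩
    enc (block (handshake z P Q))  ∎
    where
    open ≡ₛ-Reasoning
    w : Fin (suc (suc (suc n)))
    w = suc (suc (suc z))
    I : Proc (suc n)
    I = inp zero (aout zero (suc (suc z)) ∣ rename wk₂ ⟦ P ⟧)
    O J : Proc (suc (suc n))
    O = aout (suc zero) zero
    J = inp zero (rename wk2lift ⟦ Q ⟧)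

  handshake-reduct : ∀ (z : Fin n) P Q →
    ν (ν ((𝟘 ∣ (aout zero (suc (suc (suc z))) ∣ rename wk₃ ⟦ P ⟧) [ zero ]) ∣ inp zero (rename wk2lift ⟦ Q ⟧)))
    ≡ₛ enc (par (src P) (deliver z Q))
  handshake-reduct {n} z P Q = begin
    _                                         ≡⟨ cong₂ (λ W V → ν (ν ((𝟘 ∣ (aout zero (suc (suc z)) ∣ W)) ∣ inp zero V)))
                                                       (rename-square (λ _ → refl) ⟦ P ⟧)
                                                       (sym (rename-fuse lift-suc² ⟦ Q ⟧)) ⟩
    ν (ν (rename (lift suc) ((𝟘 ∣ D) ∣ J)))    ≈⟨ res-res-lift-suc ⟩
    ν ((𝟘 ∣ D) ∣ J)                           ≈⟨ s-res (s-trans (parˡ-≡ₛ (s-trans par-unitˡ par-comm)) par-assoc) ⟩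
    ν (wk ⟦ P ⟧ ∣ (aout zero (suc z) ∣ J))     ≈⟨ res-extr ⟩
    enc (par (src P) (deliver z Q))           ∎
    where
    open ≡ₛ-Reasoning
    lift-suc² : ∀ (i : Fin (suc n)) → lift (lift suc) (lift suc i) ≡ wk2lift i
    lift-suc² zero    = refl
    lift-suc² (suc i) = refl
    D J : Proc (suc n)
    D = aout zero (suc z) ∣ wk ⟦ P ⟧
    J = inp zero (rename (lift suc) ⟦ Q ⟧)

  handshake-τ : ∀ (B : Handshake n) {X} → encHandshake B —[ τ ]→ X → Step (decHandshake B) X
  handshake-τ (handshake z P Q) (t-resτ (t-resτ (t-parˡ (t-commˡ t-out t-inp)))) =
    par (src P) (deliver z Q) , handshake-reduct z P Q , inj₂ s-refl
  handshake-τ (handshake z P Q) (t-resτ (t-resτ (t-parˡ (t-parˡ ()))))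
  handshake-τ (handshake z P Q) (t-resτ (t-resτ (t-parˡ (t-parʳ ()))))
  handshake-τ (handshake z P Q) (t-resτ (t-resτ (t-parˡ (t-commʳ () _))))
  handshake-τ (handshake z P Q) (t-resτ (t-resτ (t-parˡ (t-closeˡ () _))))
  handshake-τ (handshake z P Q) (t-resτ (t-resτ (t-parˡ (t-closeʳ () _))))
  handshake-τ (handshake z P Q) (t-resτ (t-resτ (t-parʳ ())))
  handshake-τ (handshake z P Q) (t-resτ (t-resτ (t-commˡ (t-parˡ t-out) ())))
  handshake-τ (handshake z P Q) (t-resτ (t-resτ (t-commˡ (t-parʳ ()) _)))
  handshake-τ (handshake z P Q) (t-resτ (t-resτ (t-commʳ _ ())))
  handshake-τ (handshake z P Q) (t-resτ (t-resτ (t-closeˡ (t-parˡ ()) _)))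
  handshake-τ (handshake z P Q) (t-resτ (t-resτ (t-closeˡ (t-parʳ ()) _)))
  handshake-τ (handshake z P Q) (t-resτ (t-resτ (t-closeʳ _ ())))

  handshake-⟶*ₛ : ∀ (B : Handshake n) → encHandshake B ⟶*ₛ ⟦ decHandshake B ⟧
  handshake-⟶*ₛ (handshake z P Q) =
    ⟶*ₛ-trans (_ , r-res (r-res (r-par r-comm)) ◅ ε , handshake-reduct z P Q)
              (⟶*ₛ-par (≡ₛ⇒⟶*ₛ s-refl) (deliver-⟶*ₛ z Q))

  comm-start : ∀ (x z : Fin n) P Q → ⟦ out x z P ∣ inp x Q ⟧ ⟶ enc (block (handshake z P Q))
  comm-start x z P Q =
    r-struct (s-trans (s-sym res-extrʳ) (s-res par-rightComm))
             (r-res (r-par r-comm))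
             (s-trans (s-res (s-trans (parˡ-≡ₛ (parʳ-≡ₛ received)) par-rightComm)) (handshake-residual z P Q))
    where
    received : rename (lift suc) (input-residual ⟦ Q ⟧) [ zero ] ≡ₛ input-residual ⟦ Q ⟧
    received = ≡⇒≡ₛ (lift-suc-[zero] (input-residual ⟦ Q ⟧))

  administration : Administration
  administration = record
    { Hᵇ                  = Hᵇ
    ; Hⁱ                  = Hⁱ
    ; ⟦out⟧-reveals-bout  = λ { x z P (t-open (t-parˡ t-out)) → hole (z , P) , s-refl , s-refl
                              ; x z P (t-resbout (t-parˡ ())) ; x z P (t-resbout (t-parʳ ()))
                              ; x z P (t-open (t-parʳ ())) }
    ; ⟦inp⟧-reveals-bout  = λ _ _ ()
    ; ⟦out⟧-reveals-input = λ { x z P (t-resinp (t-parˡ ())) ; x z P (t-resinp (t-parʳ ())) }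
    ; ⟦inp⟧-reveals-input = λ { x Q t-inp → hole Q , s-refl , s-refl }
    ; meet                = λ { (z , P) Q → block (handshake z P Q) }
    ; meet-residual       = λ { (z , P) Q → handshake-residual z P Q }
    ; meet-prefix         = λ { x (z , P) Q → r-comm }
    ; block-τ             = handshake-τ
    ; block-settle        = handshake-⟶*ₛ
    ; comm-start          = λ x z P Q → block (handshake z P Q) , comm-start x z P Q , refl
    }

  T-B≡⟦⟧ : ∀ (P : Proc n) → T-B P ≡ ⟦ P ⟧
  T-B≡⟦⟧ 𝟘           = refl
  T-B≡⟦⟧ (out x z P) = cong (⟦out⟧ x z) (T-B≡⟦⟧ P)
  T-B≡⟦⟧ (inp x P)   = cong (⟦inp⟧ x) (T-B≡⟦⟧ P)
  T-B≡⟦⟧ (P ∣ Q)     = cong₂ _∣_ (T-B≡⟦⟧ P) (T-B≡⟦⟧ Q)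
  T-B≡⟦⟧ (ν P)       = cong ν (T-B≡⟦⟧ P)
  T-B≡⟦⟧ (! P)       = cong !_ (T-B≡⟦⟧ P)
  T-B≡⟦⟧ √           = refl

  T-B-valid : ∀ (P : Proc n) → T-B P ≈ P
  T-B-valid P = subst (_≈ P) (sym (T-B≡⟦⟧ P)) (valid (Correct.correspondence administration) P)

module HondaTokoro where

  input-residual : Fin n → Proc n → Proc (suc n)
  input-residual z R = aout zero (suc z) ∣ wk R

  bout-residual : Proc (suc n) → Proc (suc n)
  bout-residual S = 𝟘 ∣ inp zero (rename (lift suc) S)

  ⟦out⟧ : Fin n → Fin n → Proc n → Proc n
  ⟦out⟧ x z R = inp x (input-residual z R)

  ⟦inp⟧ : Fin n → Proc (suc n) → Proc n
  ⟦inp⟧ x S = ν (aout (suc x) zero ∣ inp zero (rename (lift suc) S))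

  input-residual-rename : ∀ (ρ : Fin n → Fin m) z R →
                          input-residual (ρ z) (rename ρ R) ≡ rename (lift ρ) (input-residual z R)
  input-residual-rename ρ z R = cong (aout zero (suc (ρ z)) ∣_) (sym (rename-lift-wk ρ R))

  bout-residual-rename : ∀ (ρ : Fin n → Fin m) S →
                         bout-residual (rename (lift ρ) S) ≡ rename (lift ρ) (bout-residual S)
  bout-residual-rename ρ S = cong (λ W → 𝟘 ∣ inp zero W) (sym (rename-lift-lift-suc ρ S))

  prefixes : PrefixEncoding
  prefixes = record
    { ⟦out⟧              = ⟦out⟧
    ; ⟦inp⟧              = ⟦inp⟧
    ; ⟦out⟧-rename       = λ ρ x z R → cong (inp (ρ x)) (input-residual-rename ρ z R)
    ; ⟦inp⟧-rename       = λ ρ x S → cong (λ W → ν (aout (suc (ρ x)) zero ∣ inp zero W))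
                                          (sym (rename-lift-lift-suc ρ S))
    ; ⟦out⟧-≡ₛ           = λ e → s-inp (parʳ-≡ₛ (rename-≡ₛ suc e))
    ; ⟦inp⟧-≡ₛ           = λ e → s-res (parʳ-≡ₛ (s-inp (rename-≡ₛ (lift suc) e)))
    ; ⟦out⟧-unsuccessful = λ ()
    ; ⟦inp⟧-unsuccessful = fresh-output-unsuccessful
    ; ⟦out⟧-binds        = λ { t-inp → refl }
    ; ⟦inp⟧-binds        = fresh-output-binds
    }

  open Compositional prefixes
  open AdministrativeStates prefixes noBlocks

  Hᵇ Hⁱ : Hole
  Hᵇ = inpHole bout-residual bout-residual-rename
  Hⁱ = outHole input-residual input-residual-rename

  meet-residual : ∀ (Q : Proc (suc n)) z P →
    ν (bout-residual ⟦ Q ⟧ ∣ input-residual z ⟦ P ⟧) ≡ₛ enc (par (src P) (deliver z Q))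
  meet-residual Q z P =
    s-trans (s-res (s-trans (parˡ-≡ₛ par-unitˡ) (s-trans par-comm (s-trans (parˡ-≡ₛ par-comm) par-assoc))))
            res-extr

  comm-start : ∀ (x z : Fin n) P Q → ⟦ out x z P ∣ inp x Q ⟧ ⟶ enc (par (src P) (deliver z Q))
  comm-start x z P Q =
    r-struct (s-trans (s-sym res-extr) (s-res (s-trans (s-sym par-assoc) (parˡ-≡ₛ par-comm))))
             (r-res (r-par r-comm))
             (s-trans (s-res (s-trans (parˡ-≡ₛ (s-trans par-unitˡ received)) (s-trans (parˡ-≡ₛ par-comm) par-assoc)))
                      res-extr)
    where
    received : rename (lift suc) (input-residual z ⟦ P ⟧) [ zero ] ≡ₛ input-residual z ⟦ P ⟧
    received = ≡⇒≡ₛ (lift-suc-[zero] (input-residual z ⟦ P ⟧))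

  administration : Administration
  administration = record
    { Hᵇ                  = Hᵇ
    ; Hⁱ                  = Hⁱ
    ; ⟦out⟧-reveals-bout  = λ _ _ _ ()
    ; ⟦inp⟧-reveals-bout  = λ { x Q (t-open (t-parˡ t-out)) → hole Q , s-refl , s-refl
                              ; x Q (t-resbout (t-parˡ ())) ; x Q (t-resbout (t-parʳ ()))
                              ; x Q (t-open (t-parʳ ())) }
    ; ⟦out⟧-reveals-input = λ { x z P t-inp → hole (z , P) , s-refl , s-refl }
    ; ⟦inp⟧-reveals-input = λ { x Q (t-resinp (t-parˡ ())) ; x Q (t-resinp (t-parʳ ())) }
    ; meet                = λ { Q (z , P) → par (src P) (deliver z Q) }
    ; meet-residual       = λ { Q (z , P) → meet-residual Q z P }
    ; meet-prefix         = λ { x Q (z , P) → r-struct par-comm r-comm s-refl }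
    ; block-τ             = λ ()
    ; block-settle        = λ ()
    ; comm-start          = λ x z P Q → par (src P) (deliver z Q) , comm-start x z P Q , refl
    }

  T-HT≡⟦⟧ : ∀ (P : Proc n) → T-HT P ≡ ⟦ P ⟧
  T-HT≡⟦⟧ 𝟘           = refl
  T-HT≡⟦⟧ (out x z P) = cong (⟦out⟧ x z) (T-HT≡⟦⟧ P)
  T-HT≡⟦⟧ (inp x P)   = cong (⟦inp⟧ x) (T-HT≡⟦⟧ P)
  T-HT≡⟦⟧ (P ∣ Q)     = cong₂ _∣_ (T-HT≡⟦⟧ P) (T-HT≡⟦⟧ Q)
  T-HT≡⟦⟧ (ν P)       = cong ν (T-HT≡⟦⟧ P)
  T-HT≡⟦⟧ (! P)       = cong !_ (T-HT≡⟦⟧ P)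
  T-HT≡⟦⟧ √           = refl

  T-HT-valid : ∀ (P : Proc n) → T-HT P ≈ P
  T-HT-valid P = subst (_≈ P) (sym (T-HT≡⟦⟧ P)) (valid (Correct.correspondence administration) P)

theorem2 : ((n : ℕ) (P : Proc n) → T-B P ≈ P) × ((n : ℕ) (P : Proc n) → T-HT P ≈ P)
theorem2 = (λ _ → Boudol.T-B-valid) , (λ _ → HondaTokoro.T-HT-valid)
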